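{- Under the projective change of coordinates $\mathbb{RP}^2\to\mathbb{RP}^2$ given by $[a:b:c]=\left[\tfrac{w+u}{2}:v:\tfrac{w-u}{2}\right]$, the set $\{[a:b:c]\mid b^2<4ac\}$ corresponds to the Klein disk $\{[u:v:1]\mid u^2+v^2<1\}$, and the quadratic formula $[a:b:c]\mapsto \frac{ -b\pm i\sqrt{4ac-b^2}}{2a}$ becomes the map $$[u:v:1]\mapsto \frac{ -v\pm i\sqrt{1-u^2-v^2}}{1+u},$$ which (taking the root with positive imaginary part) is precisely the usual isometry from the Klein disk model of the hyperbolic plane to the upper half plane model.
   Context: The Klein disk model is the open unit disk $\{(u,v)\mid u^2+v^2<1\}$ with distance $d((u_1,v_1),(u_2,v_2))=\operatorname{arcosh}\frac{1-u_1u_2-v_1v_2}{\sqrt{(1-u_1^2-v_1^2)(1-u_2^2-v_2^2)}}$. The upper half plane model is $\{x+iy\mid y>0\}$ with distance $\operatorname{arcosh}\left(1+\frac{(x_2-x_1)^2+(y_2-y_1)^2}{2y_1y_2}\right)$. -}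

module Defs where

open import Algebra.Bundles using (CommutativeRing)
open import Data.Nat.Base as ℕ using (ℕ; zero; suc; _!)
import Data.Nat.Properties as ℕₚ
open import Data.Integer.Base as ℤ using (ℤ; +_; -[1+_])
import Data.Integer.Properties as ℤₚ
open import Data.Maybe.Base using (Maybe; just; nothing)
open import Data.Product.Base using (_×_; _,_; proj₁; proj₂; ∃)
open import Data.Sum.Base using (_⊎_; inj₁; inj₂)
open import Data.Empty using (⊥; ⊥-elim)
open import Function.Structures using (IsBijection)
open import Level using (0ℓ)
open import Relation.Binary.Core using (Rel)
open import Relation.Binary.Structures using (IsDecTotalOrder)
import Relation.Binary.Construct.NonStrictToStrict as ToStrict
open import Relation.Binary.PropositionalEquality.Core as ≡ using (_≡_)
open import Relation.Nullary using (¬_; Dec; yes; no)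
open import Relation.Unary using (Pred; _∈_)

-- The real numbers enter as an arbitrary Dedekind-complete ordered field;
-- classically there is exactly one such field up to isomorphism.
-- The inverse is a total operation, unspecified at 0.

record CompleteOrderedField : Set₁ where
  infix 4 _≤_
  infix 9 _⁻¹
  field
    commutativeRing : CommutativeRing 0ℓ 0ℓ
  open CommutativeRing commutativeRing public
  field
    _⁻¹             : Carrier → Carrier
    _≤_             : Rel Carrier 0ℓ
    isDecTotalOrder : IsDecTotalOrder _≈_ _≤_
    0≉1             : ¬ (0# ≈ 1#)
    ⁻¹-inverseʳ     : ∀ x → ¬ (x ≈ 0#) → x * x ⁻¹ ≈ 1#
    +-monoˡ-≤       : ∀ z {x y} → x ≤ y → x + z ≤ y + z
    *-nonneg        : ∀ {x y} → 0# ≤ x → 0# ≤ y → 0# ≤ x * y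

  UpperBound : Pred Carrier 0ℓ → Pred Carrier 0ℓ
  UpperBound S b = ∀ x → x ∈ S → x ≤ b

  LeastUpperBound : Pred Carrier 0ℓ → Pred Carrier 0ℓ
  LeastUpperBound S s = UpperBound S s × (∀ b → UpperBound S b → s ≤ b)

  field
    complete : ∀ S → ∃ S → ∃ (UpperBound S) → ∃ (LeastUpperBound S)

  open IsDecTotalOrder isDecTotalOrder public
    using (antisym; total; _≟_; _≤?_; ≤-respʳ-≈; ≤-respˡ-≈)
    renaming (refl to ≤-refl; reflexive to ≤-reflexive; trans to ≤-trans)
  open ToStrict _≈_ _≤_ public using (_<_)

module Reals (R : CompleteOrderedField) where

  open CompleteOrderedField R public

  module IntegerCoefficients where
    open import Algebra.Solver.Ring.AlmostCommutativeRing
    open import Algebra.Properties.Semiring.Mult.TCOptimised semiring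
      renaming (_×_ to _·_)
    open import Algebra.Properties.Ring ring
    open import Algebra.Properties.AbelianGroup +-abelianGroup using (⁻¹-∙-comm)
    open import Relation.Binary.Reasoning.Setoid setoid

    ⟦_⟧ᶻ : ℤ → Carrier
    ⟦ + n ⟧ᶻ      = n · 1#
    ⟦ -[1+ n ] ⟧ᶻ = - (suc n · 1#)

    neg-homo : ∀ i → ⟦ ℤ.- i ⟧ᶻ ≈ - ⟦ i ⟧ᶻ
    neg-homo (+ zero)  = sym -0#≈0#
    neg-homo (+ suc n) = refl
    neg-homo -[1+ n ]  = sym (-‿involutive _)

    cancel : ∀ a b c → (c + a) - (c + b) ≈ a - b
    cancel a b c = begin
      (c + a) + - (c + b)     ≈⟨ +-cong (+-comm c a) (sym (⁻¹-∙-comm c b)) ⟩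
      (a + c) + (- c + - b)   ≈⟨ +-assoc a c _ ⟩
      a + (c + (- c + - b))   ≈⟨ +-congˡ (sym (+-assoc c (- c) _)) ⟩
      a + ((c + - c) + - b)   ≈⟨ +-congˡ (+-congʳ (-‿inverseʳ c)) ⟩
      a + (0# + - b)          ≈⟨ +-congˡ (+-identityˡ _) ⟩
      a - b                   ∎

    ⊖-homo : ∀ m n → ⟦ m ℤ.⊖ n ⟧ᶻ ≈ m · 1# - n · 1#
    ⊖-homo m zero = begin
      m · 1#        ≈⟨ sym (+-identityʳ _) ⟩
      m · 1# + 0#   ≈⟨ +-congˡ (sym -0#≈0#) ⟩
      m · 1# - 0#   ∎
    ⊖-homo zero (suc n) = sym (+-identityˡ _)
    ⊖-homo (suc m) (suc n) = begin
      ⟦ suc m ℤ.⊖ suc n ⟧ᶻ              ≡⟨ ≡.cong ⟦_⟧ᶻ (ℤₚ.[1+m]⊖[1+n]≡m⊖n m n) ⟩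
      ⟦ m ℤ.⊖ n ⟧ᶻ                      ≈⟨ ⊖-homo m n ⟩
      m · 1# - n · 1#                   ≈⟨ sym (cancel _ _ 1#) ⟩
      (1# + m · 1#) - (1# + n · 1#)     ≈⟨ sym (+-cong (1+× m 1#) (-‿cong (1+× n 1#))) ⟩
      suc m · 1# - suc n · 1#           ∎

    +-homo : ∀ i j → ⟦ i ℤ.+ j ⟧ᶻ ≈ ⟦ i ⟧ᶻ + ⟦ j ⟧ᶻ
    +-homo (+ m) (+ n)       = ×-homo-+ 1# m n
    +-homo (+ m) -[1+ n ]    = ⊖-homo m (suc n)
    +-homo -[1+ m ] (+ n)    = trans (⊖-homo n (suc m)) (+-comm _ _)
    +-homo -[1+ m ] -[1+ n ] = begin
      - (suc (suc (m ℕ.+ n)) · 1#)      ≡⟨ ≡.cong (λ k → - (k · 1#)) (≡.sym (ℕₚ.+-suc (suc m) n)) ⟩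
      - ((suc m ℕ.+ suc n) · 1#)        ≈⟨ -‿cong (×-homo-+ 1# (suc m) (suc n)) ⟩
      - (suc m · 1# + suc n · 1#)       ≈⟨ sym (⁻¹-∙-comm _ _) ⟩
      - (suc m · 1#) - (suc n · 1#)     ∎

    *-homo : ∀ i j → ⟦ i ℤ.* j ⟧ᶻ ≈ ⟦ i ⟧ᶻ * ⟦ j ⟧ᶻ
    *-homo (+ m) (+ n) = begin
      ⟦ (+ m) ℤ.* (+ n) ⟧ᶻ ≡⟨ ≡.cong ⟦_⟧ᶻ (ℤₚ.+◃n≡+n (m ℕ.* n)) ⟩
      (m ℕ.* n) · 1#       ≈⟨ ×1-homo-* m n ⟩
      (m · 1#) * (n · 1#)  ∎
    *-homo (+ m) -[1+ n ] = begin
      ⟦ (+ m) ℤ.* -[1+ n ] ⟧ᶻ   ≡⟨ ≡.cong ⟦_⟧ᶻ (ℤₚ.-◃n≡-n (m ℕ.* suc n)) ⟩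
      ⟦ ℤ.- + (m ℕ.* suc n) ⟧ᶻ  ≈⟨ neg-homo (+ (m ℕ.* suc n)) ⟩
      - ((m ℕ.* suc n) · 1#)    ≈⟨ -‿cong (×1-homo-* m (suc n)) ⟩
      - (m · 1# * suc n · 1#)   ≈⟨ -‿distribʳ-* _ _ ⟩
      m · 1# * - (suc n · 1#)   ∎
    *-homo -[1+ m ] (+ n) = begin
      ⟦ -[1+ m ] ℤ.* (+ n) ⟧ᶻ   ≡⟨ ≡.cong ⟦_⟧ᶻ (ℤₚ.-◃n≡-n (suc m ℕ.* n)) ⟩
      ⟦ ℤ.- + (suc m ℕ.* n) ⟧ᶻ  ≈⟨ neg-homo (+ (suc m ℕ.* n)) ⟩
      - ((suc m ℕ.* n) · 1#)    ≈⟨ -‿cong (×1-homo-* (suc m) n) ⟩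
      - (suc m · 1# * n · 1#)   ≈⟨ -‿distribˡ-* _ _ ⟩
      - (suc m · 1#) * n · 1#   ∎
    *-homo -[1+ m ] -[1+ n ] = begin
      (suc m ℕ.* suc n) · 1#            ≈⟨ ×1-homo-* (suc m) (suc n) ⟩
      suc m · 1# * suc n · 1#           ≈⟨ sym (-‿involutive _) ⟩
      - - (suc m · 1# * suc n · 1#)     ≈⟨ -‿cong (-‿distribˡ-* _ _) ⟩
      - (- (suc m · 1#) * suc n · 1#)   ≈⟨ -‿distribʳ-* _ _ ⟩
      - (suc m · 1#) * - (suc n · 1#)   ∎

    morphism : ℤ.+-*-rawRing -Raw-AlmostCommutative⟶ fromCommutativeRing commutativeRing
    morphism = record
      { ⟦_⟧ = ⟦_⟧ᶻ ; +-homo = +-homo ; *-homo = *-homo ; -‿homo = neg-homo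
      ; 0-homo = refl ; 1-homo = refl }

    coeff≟ : ∀ i j → Maybe (⟦ i ⟧ᶻ ≈ ⟦ j ⟧ᶻ)
    coeff≟ i j with i ℤₚ.≟ j
    ... | yes i≡j = just (reflexive (≡.cong ⟦_⟧ᶻ i≡j))
    ... | no  _   = nothing

    open import Algebra.Solver.Ring ℤ.+-*-rawRing
      (fromCommutativeRing commutativeRing) morphism coeff≟ public
      using (solve; _:=_; _:+_; _:*_; _:-_; :-_; con)

  open IntegerCoefficients using (solve; _:=_; _:+_; _:*_; _:-_; :-_; con)

  -- Inequalities are proved by certificates: p ≤ q follows from an
  -- identity q - p ≈ e with e visibly nonnegative.

  ≤-by : ∀ {p q e} → 0# ≤ e → q - p ≈ e → p ≤ q
  ≤-by {p} {q} {e} 0≤e q-p≈e =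
    ≤-respˡ-≈ (+-identityˡ p) (≤-respʳ-≈ eq (+-monoˡ-≤ p 0≤e))
    where
    eq : e + p ≈ q
    eq = trans (+-congʳ (sym q-p≈e)) (solve 2 (λ p q → (q :- p) :+ p := q) refl p q)

  sub≥0 : ∀ {p q} → p ≤ q → 0# ≤ q - p
  sub≥0 {p} p≤q = ≤-respˡ-≈ (-‿inverseʳ p) (+-monoˡ-≤ (- p) p≤q)

  ≥0-resp : ∀ {x y} → x ≈ y → 0# ≤ x → 0# ≤ y
  ≥0-resp = ≤-respʳ-≈

  ≈0⇒≥0 : ∀ {x} → x ≈ 0# → 0# ≤ x
  ≈0⇒≥0 x≈0 = ≤-reflexive (sym x≈0)

  infixl 6 _⊕_ _⊕ˢ_
  infixl 7 _⊗_ _⊗ˢ_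

  _⊕_ : ∀ {x y} → 0# ≤ x → 0# ≤ y → 0# ≤ x + y
  _⊕_ {x} {y} p q = ≤-trans q (≤-respˡ-≈ (+-identityˡ y) (+-monoˡ-≤ y p))

  _⊗_ : ∀ {x y} → 0# ≤ x → 0# ≤ y → 0# ≤ x * y
  _⊗_ = *-nonneg

  >0⇒≉0 : ∀ {x} → 0# < x → ¬ (x ≈ 0#)
  >0⇒≉0 (_ , 0≉x) x≈0 = 0≉x (sym x≈0)

  _⊕ˢ_ : ∀ {x y} → 0# < x → 0# ≤ y → 0# < x + y
  _⊕ˢ_ {x} {y} (0≤x , 0≉x) 0≤y = 0≤x ⊕ 0≤y , λ 0≈x+y →
    0≉x (antisym 0≤x (≤-by 0≤y (trans
      (solve 2 (λ x y → con (+ 0) :- x := y :- (x :+ y)) refl x y)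
      (trans (+-congˡ (-‿cong (sym 0≈x+y))) (solve 1 (λ y → y :- con (+ 0) := y) refl y)))))

  *-cancel-≉0 : ∀ {x y} → ¬ (y ≈ 0#) → x * y ≈ 0# → x ≈ 0#
  *-cancel-≉0 {x} {y} y≉0 xy≈0 = begin
    x               ≈⟨ sym (*-identityʳ x) ⟩
    x * 1#          ≈⟨ *-congˡ (sym (⁻¹-inverseʳ y y≉0)) ⟩
    x * (y * y ⁻¹)  ≈⟨ sym (*-assoc x y _) ⟩
    x * y * y ⁻¹    ≈⟨ *-congʳ xy≈0 ⟩
    0# * y ⁻¹       ≈⟨ zeroˡ _ ⟩
    0#              ∎
    where open import Relation.Binary.Reasoning.Setoid setoid

  _⊗ˢ_ : ∀ {x y} → 0# < x → 0# < y → 0# < x * y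
  p ⊗ˢ q = proj₁ p ⊗ proj₁ q , λ 0≈xy → >0⇒≉0 p (*-cancel-≉0 (>0⇒≉0 q) (sym 0≈xy))

  >0-resp : ∀ {x y} → x ≈ y → 0# < x → 0# < y
  >0-resp x≈y (p , q) = ≤-respʳ-≈ x≈y p , λ 0≈y → q (trans 0≈y (sym x≈y))

  sub>0 : ∀ {p q} → p < q → 0# < q - p
  sub>0 {p} {q} (p≤q , p≉q) = sub≥0 p≤q , λ 0≈q-p →
    p≉q (trans (sym (+-identityˡ p)) (trans (+-congʳ 0≈q-p)
      (solve 2 (λ p q → (q :- p) :+ p := q) refl p q)))

  <-by : ∀ {p q e} → 0# < e → q - p ≈ e → p < q
  <-by 0<e q-p≈e = ≤-by (proj₁ 0<e) q-p≈e , λ p≈q →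
    proj₂ 0<e (trans (trans (sym (-‿inverseʳ _)) (+-congʳ p≈q)) q-p≈e)

  ≰⇒> : ∀ {x y} → ¬ (x ≤ y) → y < x
  ≰⇒> {x} {y} x≰y with total x y
  ... | inj₁ x≤y = ⊥-elim (x≰y x≤y)
  ... | inj₂ y≤x = y≤x , λ y≈x → x≰y (≤-reflexive (sym y≈x))

  <⇒≱ : ∀ {x y} → x < y → ¬ (y ≤ x)
  <⇒≱ (x≤y , x≉y) y≤x = x≉y (antisym x≤y y≤x)

  ≯⇒≤ : ∀ {x y} → ¬ (y < x) → x ≤ y
  ≯⇒≤ {x} {y} y≮x with x ≤? y
  ... | yes x≤y = x≤y
  ... | no  x≰y = ⊥-elim (y≮x (≰⇒> x≰y))

  absurd : ∀ {p q} → 0# < p → 0# ≤ q → p + q ≈ 0# → ⊥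
  absurd p q eq = >0⇒≉0 (p ⊕ˢ q) eq

  sq≥0 : ∀ x → 0# ≤ x * x
  sq≥0 x with total 0# x
  ... | inj₁ p = p ⊗ p
  ... | inj₂ p = ≥0-resp (solve 1 (λ x → (con (+ 0) :- x) :* (con (+ 0) :- x) := x :* x) refl x)
                         (sub≥0 p ⊗ sub≥0 p)

  0≤1 : 0# ≤ 1#
  0≤1 = ≥0-resp (*-identityˡ 1#) (sq≥0 1#)

  0<1 : 0# < 1#
  0<1 = 0≤1 , 0≉1

  ⁻¹-pos : ∀ {x} → 0# < x → 0# < x ⁻¹
  ⁻¹-pos {x} 0<x with x ⁻¹ ≤? 0#
  ... | no  x⁻¹≰0 = ≰⇒> x⁻¹≰0
  ... | yes x⁻¹≤0 = ⊥-elim (absurd 0<1 (proj₁ 0<x ⊗ sub≥0 x⁻¹≤0)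
      (trans (+-congʳ (sym (⁻¹-inverseʳ x (>0⇒≉0 0<x))))
        (solve 2 (λ x y → x :* y :+ x :* (con (+ 0) :- y) := con (+ 0)) refl x (x ⁻¹))))

  2# 4# : Carrier
  2# = 1# + 1#
  4# = 2# + 2#

  0<2 : 0# < 2#
  0<2 = 0<1 ⊕ˢ 0≤1

  -- Intermediate values of convex functions.  Convexity is the three-chord
  -- inequality cleared of denominators, and is only asked for on [0,∞).

  Increasing Convex : (Carrier → Carrier) → Set
  Increasing f = ∀ a b → 0# ≤ a → a ≤ b → f a ≤ f b
  Convex f = ∀ a b c → 0# ≤ a → a ≤ b → b ≤ c →
    (c - a) * f b ≤ (c - b) * f a + (b - a) * f c

  fraction : ∀ {δ B} → 0# < δ → 0# ≤ B →
    ∃ λ θ → 0# < θ × 0# ≤ 1# - θ × (θ * (δ + B) ≈ δ)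
  fraction {δ} {B} 0<δ 0≤B =
    δ * (δ + B) ⁻¹ , 0<δ ⊗ˢ 0<D⁻¹ ,
    ≥0-resp (trans eq₁ (+-congʳ unit)) (0≤B ⊗ proj₁ 0<D⁻¹) ,
    trans (solve 3 (λ δ B i → δ :* i :* (δ :+ B) := δ :* ((δ :+ B) :* i)) refl δ B _)
          (trans (*-congˡ unit) (*-identityʳ δ))
    where
    0<D : 0# < δ + B
    0<D = 0<δ ⊕ˢ 0≤B
    0<D⁻¹ = ⁻¹-pos 0<D
    unit = ⁻¹-inverseʳ (δ + B) (>0⇒≉0 0<D)
    eq₁ = solve 3 (λ δ B i → B :* i := (δ :+ B) :* i :- δ :* i) refl δ B ((δ + B) ⁻¹)

  ivt : ∀ (f : Carrier → Carrier) → Increasing f → Convex f → 0# ≤ f 0# →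
        ∀ y M → 0# ≤ M → f 0# ≤ y → y ≤ f M → ∃ λ s → 0# ≤ s × (f s ≈ y)
  ivt f mono conv 0≤f0 y M 0≤M f0≤y y≤fM with y ≤? f 0#
  ... | yes y≤f0 = 0# , ≤-refl , antisym f0≤y y≤f0
  ... | no  y≰f0 = proj₁ lub , proj₁ (proj₂ lub) 0# (≤-refl , f0≤y) ,
      at-lub (proj₁ lub) (proj₁ (proj₂ lub)) (proj₂ (proj₂ lub))
    where
    f0<y = ≰⇒> y≰f0

    S : Pred Carrier 0ℓ
    S t = 0# ≤ t × f t ≤ y

    bounded : UpperBound S M
    bounded t (0≤t , ft≤y) = ≯⇒≤ λ M<t → absurd
      (sub>0 M<t ⊗ˢ sub>0 f0<y)
      (sub≥0 (conv 0# M t ≤-refl 0≤M (proj₁ M<t)) ⊕ 0≤t ⊗ sub≥0 y≤fM ⊕ 0≤M ⊗ sub≥0 ft≤y)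
      (solve 6 (λ t M y f0 ft fM →
          (t :- M) :* (y :- f0) :+
          ((t :- M) :* f0 :+ (M :- con (+ 0)) :* ft :- (t :- con (+ 0)) :* fM
            :+ t :* (fM :- y) :+ M :* (y :- ft)) := con (+ 0))
        refl t M y (f 0#) (f t) (f M))

    at-lub : ∀ s → UpperBound S s → (∀ b → UpperBound S b → s ≤ b) → f s ≈ y
    at-lub s ub least = antisym (≯⇒≤ not-above) (≯⇒≤ not-below)
      where
        0≤s : 0# ≤ s
        0≤s = ub 0# (≤-refl , f0≤y)

        s≤s+1 : s ≤ s + 1#
        s≤s+1 = ≤-by 0≤1 (solve 1 (λ s → s :+ con (+ 1) :- s := con (+ 1)) refl s)

        nonneg : ∀ t → 0# ≤ t → 0# ≤ f t
        nonneg t 0≤t = ≤-trans 0≤f0 (mono 0# t ≤-refl 0≤t)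

        not-below : ¬ (f s < y)
        not-below fs<y = step (fraction (sub>0 fs<y) (nonneg (s + 1#) (0≤s ⊕ 0≤1)))
          where
          step : (∃ λ θ → 0# < θ × 0# ≤ 1# - θ × (θ * (y - f s + f (s + 1#)) ≈ y - f s)) → ⊥
          step (θ , 0<θ , 0≤1-θ , θD≈δ) = absurd 0<θ (sub≥0 (ub p (0≤s ⊕ proj₁ 0<θ , fp≤y)))
                (solve 2 (λ s θ → θ :+ (s :- (s :+ θ)) := con (+ 0)) refl s θ)
              where
              p = s + θ
              B = f (s + 1#)
              fp≤y : f p ≤ y
              fp≤y = ≤-by
                (sub≥0 (conv s p (s + 1#) 0≤s
                    (≤-by (proj₁ 0<θ) (solve 2 (λ s θ → s :+ θ :- s := θ) refl s θ))
                    (≤-by 0≤1-θ (solve 2 (λ s θ → s :+ con (+ 1) :- (s :+ θ) := con (+ 1) :- θ) refl s θ)))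
                  ⊕ proj₁ 0<θ ⊗ nonneg s 0≤s ⊕ proj₁ 0<θ ⊗ proj₁ (sub>0 fs<y)
                  ⊕ sub≥0 (≤-reflexive θD≈δ))
                (solve 6 (λ s θ y fs fp B →
                    y :- fp :=
                    ((s :+ con (+ 1) :- (s :+ θ)) :* fs :+ (s :+ θ :- s) :* B :- (s :+ con (+ 1) :- s) :* fp)
                    :+ θ :* fs :+ θ :* (y :- fs) :+ (y :- fs :- θ :* (y :- fs :+ B)))
                  refl s θ y (f s) (f p) B)

        not-above : ¬ (y < f s)
        not-above y<fs = step (fraction (sub>0 y<fs)
                                        (0≤s ⊗ sub≥0 (mono s (s + 1#) 0≤s s≤s+1)))
          where
          step : (∃ λ θ → 0# < θ × 0# ≤ 1# - θ
                   × (θ * (f s - y + s * (f (s + 1#) - f s)) ≈ f s - y)) → ⊥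
          step (θ , 0<θ , 0≤1-θ , θD≈δ) = absurd (0<θ ⊗ˢ sub>0 y<fs)
                (sub≥0 (conv t s (s + 1#) 0≤t t≤s s≤s+1) ⊕ sub≥0 ft≤y
                  ⊕ sub≥0 (≤-reflexive θD≈δ))
                (solve 6 (λ s θ y fs ft B →
                    θ :* (fs :- y) :+
                    (((s :+ con (+ 1) :- s) :* ft :+ (s :- (s :- θ :* s)) :* B
                       :- (s :+ con (+ 1) :- (s :- θ :* s)) :* fs)
                      :+ (y :- ft) :+ (fs :- y :- θ :* (fs :- y :+ s :* (B :- fs)))) := con (+ 0))
                  refl s θ y (f s) (f t) (f (s + 1#)))
              where
              t = s - θ * s
              t≤s : t ≤ s
              t≤s = ≤-by (proj₁ 0<θ ⊗ 0≤s) (solve 2 (λ s θ → s :- (s :- θ :* s) := θ :* s) refl s θ)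
              0≤t : 0# ≤ t
              0≤t = ≥0-resp (solve 2 (λ s θ → (con (+ 1) :- θ) :* s := s :- θ :* s) refl s θ) (0≤1-θ ⊗ 0≤s)
              0<s : 0# < s
              0<s = ≰⇒> λ s≤0 → <⇒≱ y<fs (≤-trans (mono s 0# 0≤s s≤0) f0≤y)
              ft≤y : f t ≤ y
              ft≤y = ≯⇒≤ λ y<ft → absurd (0<θ ⊗ˢ 0<s)
                (sub≥0 (least t λ a a∈S → ≯⇒≤ λ t<a →
                  <⇒≱ y<ft (≤-trans (mono t a 0≤t (proj₁ t<a)) (proj₂ a∈S))))
                (solve 2 (λ s θ → θ :* s :+ (s :- θ :* s :- s) := con (+ 0)) refl s θ)

    lub = complete S (0# , ≤-refl , f0≤y) (M , bounded)

  square-increasing : Increasing (λ t → t * t)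
  square-increasing a b 0≤a a≤b = ≤-by (sub≥0 a≤b ⊗ (0≤a ⊕ ≤-trans 0≤a a≤b))
    (solve 2 (λ a b → b :* b :- a :* a := (b :- a) :* (a :+ b)) refl a b)

  square-convex : Convex (λ t → t * t)
  square-convex a b c 0≤a a≤b b≤c =
    ≤-by (sub≥0 b≤c ⊗ sub≥0 a≤b ⊗ sub≥0 (≤-trans a≤b b≤c))
      (solve 3 (λ a b c → (c :- b) :* (a :* a) :+ (b :- a) :* (c :* c) :- (c :- a) :* (b :* b)
                  := (c :- b) :* (b :- a) :* (c :- a)) refl a b c)

  opaque
    sqrt-exists : ∀ x → 0# ≤ x → ∃ λ s → 0# ≤ s × (s * s ≈ x)
    sqrt-exists x 0≤x = ivt (λ t → t * t) square-increasing square-convex (sq≥0 0#)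
      x (x + 1#) (0≤x ⊕ 0≤1) (≤-respˡ-≈ (sym (zeroˡ 0#)) 0≤x)
      (≤-by (sq≥0 x ⊕ 0≤x ⊕ 0≤1)
        (solve 1 (λ x → (x :+ con (+ 1)) :* (x :+ con (+ 1)) :- x := x :* x :+ x :+ con (+ 1)) refl x))

  -- The value 0 at negative arguments is a convention.
  √ : Carrier → Carrier
  √ x with 0# ≤? x
  ... | yes 0≤x = proj₁ (sqrt-exists x 0≤x)
  ... | no  _   = 0#

  open import Algebra.Properties.Semiring.Exp semiring using (_^_; ^-congʳ; ^-congˡ)
  open import Algebra.Properties.Semiring.Mult.TCOptimised semiring
    using (×1-homo-*; ×-homo-+; 1+×) renaming (_×_ to _·_)

  fromℕ : ℕ → Carrier
  fromℕ n = n · 1#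

  coshTerm : Carrier → ℕ → Carrier
  coshTerm t k = t ^ (2 ℕ.* k) * fromℕ ((2 ℕ.* k) !) ⁻¹

  coshSum : Carrier → ℕ → Carrier
  coshSum t zero    = coshTerm t 0
  coshSum t (suc n) = coshSum t n + coshTerm t (suc n)

  CoshSums : Carrier → Pred Carrier 0ℓ
  CoshSums t x = ∃ λ n → x ≈ coshSum t n

  fromℕ-nonneg : ∀ n → 0# ≤ fromℕ n
  fromℕ-nonneg zero    = ≤-refl
  fromℕ-nonneg (suc n) = ≥0-resp (sym (1+× n 1#)) (0≤1 ⊕ fromℕ-nonneg n)

  fromℕ-suc-pos : ∀ n → 0# < fromℕ (suc n)
  fromℕ-suc-pos n = >0-resp (sym (1+× n 1#)) (0<1 ⊕ˢ fromℕ-nonneg n)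

  fromℕ-!-pos : ∀ n → 0# < fromℕ (n !)
  fromℕ-!-pos zero    = 0<1
  fromℕ-!-pos (suc n) =
    >0-resp (sym (×1-homo-* (suc n) (n !))) (fromℕ-suc-pos n ⊗ˢ fromℕ-!-pos n)

  fact⁻¹-pos : ∀ k → 0# < fromℕ ((2 ℕ.* k) !) ⁻¹
  fact⁻¹-pos k = ⁻¹-pos (fromℕ-!-pos (2 ℕ.* k))

  ^-suc : ∀ t k → t ^ (2 ℕ.* suc k) ≈ t * (t * t ^ (2 ℕ.* k))
  ^-suc t k = ^-congʳ t (ℕₚ.*-suc 2 k)

  ^-nonneg : ∀ {t} n → 0# ≤ t → 0# ≤ t ^ n
  ^-nonneg zero    0≤t = 0≤1
  ^-nonneg (suc n) 0≤t = 0≤t ⊗ ^-nonneg n 0≤t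

  ^-even-nonneg : ∀ t k → 0# ≤ t ^ (2 ℕ.* k)
  ^-even-nonneg t zero    = 0≤1
  ^-even-nonneg t (suc k) =
    ≥0-resp (trans (*-assoc t t _) (sym (^-suc t k))) (sq≥0 t ⊗ ^-even-nonneg t k)

  ^-increasing : ∀ n → Increasing (_^ n)
  ^-increasing zero    a b 0≤a a≤b = ≤-refl
  ^-increasing (suc n) a b 0≤a a≤b =
    ≤-by (sub≥0 a≤b ⊗ ^-nonneg n (≤-trans 0≤a a≤b) ⊕ 0≤a ⊗ sub≥0 (^-increasing n a b 0≤a a≤b))
      (solve 4 (λ a b p q → b :* q :- a :* p := (b :- a) :* q :+ a :* (q :- p))
        refl a b (a ^ n) (b ^ n))

  ^-convex : ∀ n → Convex (_^ n)
  ^-convex zero    a b c 0≤a a≤b b≤c = ≤-reflexive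
    (solve 3 (λ a b c → (c :- a) :* con (+ 1) := (c :- b) :* con (+ 1) :+ (b :- a) :* con (+ 1))
      refl a b c)
  ^-convex (suc n) a b c 0≤a a≤b b≤c =
    ≤-by (≤-trans 0≤a a≤b ⊗ sub≥0 (^-convex n a b c 0≤a a≤b b≤c)
          ⊕ sub≥0 b≤c ⊗ sub≥0 a≤b ⊗ sub≥0 (^-increasing n a c 0≤a (≤-trans a≤b b≤c)))
      (solve 6 (λ a b c p q r →
          (c :- b) :* (a :* p) :+ (b :- a) :* (c :* r) :- (c :- a) :* (b :* q) :=
          b :* ((c :- b) :* p :+ (b :- a) :* r :- (c :- a) :* q) :+ (c :- b) :* (b :- a) :* (r :- p))
        refl a b c (a ^ n) (b ^ n) (c ^ n))

  coshTerm-nonneg : ∀ t k → 0# ≤ coshTerm t k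
  coshTerm-nonneg t k = ^-even-nonneg t k ⊗ proj₁ (fact⁻¹-pos k)

  coshTerm-increasing : ∀ k → Increasing (λ t → coshTerm t k)
  coshTerm-increasing k a b 0≤a a≤b =
    ≤-by (sub≥0 (^-increasing (2 ℕ.* k) a b 0≤a a≤b) ⊗ proj₁ (fact⁻¹-pos k))
      (solve 3 (λ p q c → q :* c :- p :* c := (q :- p) :* c) refl
        (a ^ (2 ℕ.* k)) (b ^ (2 ℕ.* k)) _)

  coshTerm-convex : ∀ k → Convex (λ t → coshTerm t k)
  coshTerm-convex k a b c 0≤a a≤b b≤c =
    ≤-by (sub≥0 (^-convex (2 ℕ.* k) a b c 0≤a a≤b b≤c) ⊗ proj₁ (fact⁻¹-pos k))
      (solve 7 (λ a b c p q r i →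
          (c :- b) :* (p :* i) :+ (b :- a) :* (r :* i) :- (c :- a) :* (q :* i) :=
          ((c :- b) :* p :+ (b :- a) :* r :- (c :- a) :* q) :* i)
        refl a b c (a ^ (2 ℕ.* k)) (b ^ (2 ℕ.* k)) (c ^ (2 ℕ.* k)) _)

  coshSum-increasing : ∀ n → Increasing (λ t → coshSum t n)
  coshSum-increasing zero    = coshTerm-increasing 0
  coshSum-increasing (suc n) a b 0≤a a≤b =
    ≤-by (sub≥0 (coshSum-increasing n a b 0≤a a≤b) ⊕ sub≥0 (coshTerm-increasing (suc n) a b 0≤a a≤b))
      (solve 4 (λ a b c d → b :+ d :- (a :+ c) := b :- a :+ (d :- c)) refl _ _ _ _)

  coshSum-convex : ∀ n → Convex (λ t → coshSum t n)
  coshSum-convex zero    = coshTerm-convex 0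
  coshSum-convex (suc n) a b c 0≤a a≤b b≤c =
    ≤-by (sub≥0 (coshSum-convex n a b c 0≤a a≤b b≤c) ⊕ sub≥0 (coshTerm-convex (suc n) a b c 0≤a a≤b b≤c))
      (identity a b c _ _ _ _ _ _)
    where
    identity : ∀ a b c x y z x′ y′ z′ →
      (c - b) * (x + x′) + (b - a) * (z + z′) - (c - a) * (y + y′) ≈
      ((c - b) * x + (b - a) * z - (c - a) * y) + ((c - b) * x′ + (b - a) * z′ - (c - a) * y′)
    identity = solve 9 (λ a b c x y z x′ y′ z′ →
      (c :- b) :* (x :+ x′) :+ (b :- a) :* (z :+ z′) :- (c :- a) :* (y :+ y′) :=
      ((c :- b) :* x :+ (b :- a) :* z :- (c :- a) :* y) :+ ((c :- b) :* x′ :+ (b :- a) :* z′ :- (c :- a) :* y′)) refl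

  1⁻¹≈1 : 1# ⁻¹ ≈ 1#
  1⁻¹≈1 = trans (sym (*-identityˡ _)) (⁻¹-inverseʳ 1# (>0⇒≉0 0<1))

  coshTerm-0 : ∀ t → coshTerm t 0 ≈ 1#
  coshTerm-0 t = trans (*-identityˡ _) 1⁻¹≈1

  ≤-step : ∀ {x y} → 0# ≤ y → x ≤ x + y
  ≤-step {x} {y} 0≤y = ≤-by 0≤y (solve 2 (λ x y → x :+ y :- x := y) refl x y)

  coshSum-≥1 : ∀ t n → 1# ≤ coshSum t n
  coshSum-≥1 t zero    = ≤-reflexive (sym (coshTerm-0 t))
  coshSum-≥1 t (suc n) = ≤-trans (coshSum-≥1 t n) (≤-step (coshTerm-nonneg t (suc n)))

  fact⁻¹-suc : ∀ k → fromℕ ((2 ℕ.* k) !) ⁻¹ ≈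
    fromℕ ((2 ℕ.* suc k) !) ⁻¹ * ((2# + 2# * fromℕ k) * (1# + 2# * fromℕ k))
  fact⁻¹-suc k = begin
    F ⁻¹                          ≈⟨ sym (*-identityʳ _) ⟩
    F ⁻¹ * 1#                     ≈⟨ *-congˡ (sym (⁻¹-inverseʳ F′ (>0⇒≉0 (fromℕ-!-pos (2 ℕ.* suc k))))) ⟩
    F ⁻¹ * (F′ * F′ ⁻¹)           ≈⟨ *-congˡ (*-congʳ F′≈) ⟩
    F ⁻¹ * (A * (B * F) * F′ ⁻¹)  ≈⟨ solve 5 (λ f f⁻ a b i → f⁻ :* (a :* (b :* f) :* i) := f :* f⁻ :* (i :* (a :* b)))
                                       refl F (F ⁻¹) A B (F′ ⁻¹) ⟩
    F * F ⁻¹ * (F′ ⁻¹ * (A * B))  ≈⟨ *-congʳ (⁻¹-inverseʳ F (>0⇒≉0 (fromℕ-!-pos (2 ℕ.* k)))) ⟩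
    1# * (F′ ⁻¹ * (A * B))        ≈⟨ *-identityˡ _ ⟩
    F′ ⁻¹ * (A * B)               ∎
    where
    open import Relation.Binary.Reasoning.Setoid setoid
    F = fromℕ ((2 ℕ.* k) !)
    F′ = fromℕ ((2 ℕ.* suc k) !)
    A = 2# + 2# * fromℕ k
    B = 1# + 2# * fromℕ k
    B≈ : fromℕ (suc (2 ℕ.* k)) ≈ B
    B≈ = trans (1+× (2 ℕ.* k) 1#) (+-congˡ (×1-homo-* 2 k))
    A≈ : fromℕ (suc (suc (2 ℕ.* k))) ≈ A
    A≈ = trans (1+× (suc (2 ℕ.* k)) 1#) (trans (+-congˡ B≈) (sym (+-assoc 1# 1# _)))
    F′≈ : F′ ≈ A * (B * F)
    F′≈ = begin
      F′                               ≡⟨ ≡.cong (λ n → fromℕ (n !)) (ℕₚ.*-suc 2 k) ⟩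
      fromℕ (suc (suc (2 ℕ.* k)) !)    ≈⟨ ×1-homo-* (suc (suc (2 ℕ.* k))) (suc (2 ℕ.* k) !) ⟩
      fromℕ (suc (suc (2 ℕ.* k))) * fromℕ (suc (2 ℕ.* k) !)
                                       ≈⟨ *-cong A≈ (trans (×1-homo-* (suc (2 ℕ.* k)) ((2 ℕ.* k) !)) (*-congʳ B≈)) ⟩
      A * (B * F)                      ∎

  coshTerm-halves : ∀ t k → t * t ≤ fromℕ k →
    coshTerm t (suc k) + coshTerm t (suc k) ≤ coshTerm t k
  coshTerm-halves t k t²≤k = ≤-by
    (^-even-nonneg t k ⊗ proj₁ (fact⁻¹-pos (suc k)) ⊗
      (proj₁ 0<2 ⊗ (sub≥0 t²≤k ⊕ κ≥0 ⊕ κ≥0 ⊕ proj₁ 0<2 ⊗ (κ≥0 ⊗ κ≥0) ⊕ 0≤1)))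
    (trans (+-cong (*-congˡ (fact⁻¹-suc k)) (-‿cong (+-cong eq eq)))
      (solve 4 (λ t p c κ →
          p :* (c :* ((two :+ two :* κ) :* (con (+ 1) :+ two :* κ))) :-
            (t :* (t :* p) :* c :+ t :* (t :* p) :* c) :=
          p :* c :* (two :* (κ :- t :* t :+ κ :+ κ :+ two :* (κ :* κ) :+ con (+ 1))))
        refl t (t ^ (2 ℕ.* k)) (fromℕ ((2 ℕ.* suc k) !) ⁻¹) (fromℕ k)))
    where
    κ≥0 = fromℕ-nonneg k
    two = λ {n} → con {n} (+ 1) :+ con (+ 1)
    eq : coshTerm t (suc k) ≈ t * (t * t ^ (2 ℕ.* k)) * fromℕ ((2 ℕ.* suc k) !) ⁻¹
    eq = *-congʳ (^-suc t k)

  coshSum-bounded-by : ∀ t N → t * t ≤ fromℕ N → ∀ n → coshSum t n ≤ coshSum t N + coshTerm t N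
  coshSum-bounded-by t N t²≤N n = ≤-trans (upto n) (≤-trans (≤-step (coshTerm-nonneg t (n ℕ.+ N))) (tail n))
    where
    upto : ∀ n → coshSum t n ≤ coshSum t (n ℕ.+ N)
    upto n = ≡.subst (λ k → coshSum t n ≤ coshSum t k) (ℕₚ.+-comm N n) (more N)
      where
      more : ∀ m → coshSum t n ≤ coshSum t (m ℕ.+ n)
      more zero    = ≤-refl
      more (suc m) = ≤-trans (more m) (≤-step (coshTerm-nonneg t (suc m ℕ.+ n)))
    tail : ∀ m → coshSum t (m ℕ.+ N) + coshTerm t (m ℕ.+ N) ≤ coshSum t N + coshTerm t N
    tail zero    = ≤-refl
    tail (suc m) = ≤-trans
      (≤-by (sub≥0 (coshTerm-halves t (m ℕ.+ N) (≤-trans t²≤N N≤m+N)))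
        (solve 3 (λ s x y → s :+ x :- (s :+ y :+ y) := x :- (y :+ y)) refl _ _ _))
      (tail m)
      where
      N≤m+N : fromℕ N ≤ fromℕ (m ℕ.+ N)
      N≤m+N = ≤-by (fromℕ-nonneg m) (trans (+-congʳ (×-homo-+ 1# m N))
        (solve 2 (λ m n → m :+ n :- n := m) refl (fromℕ m) (fromℕ N)))

  archimedean : ∀ x → ¬ ¬ (∃ λ n → x ≤ fromℕ n)
  archimedean x none = absurd 0<1
      (sub≥0 (proj₂ (proj₂ lub) (s - 1#) λ y y∈S → ≤-respˡ-≈ (sym (proj₂ y∈S)) (below (proj₁ y∈S))))
      (solve 1 (λ s → con (+ 1) :+ (s :- con (+ 1) :- s) := con (+ 0)) refl s)
    where
    S : Pred Carrier 0ℓ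
    S y = ∃ λ n → y ≈ fromℕ n
    lub = complete S (0# , 0 , refl)
      (x , λ y y∈S → ≤-respˡ-≈ (sym (proj₂ y∈S)) (≯⇒≤ λ x<n → none (proj₁ y∈S , proj₁ x<n)))
    s = proj₁ lub
    below : ∀ n → fromℕ n ≤ s - 1#
    below n = ≤-by (sub≥0 (proj₁ (proj₂ lub) (fromℕ (suc n)) (suc n , refl)))
      (trans (solve 2 (λ s n → s :- con (+ 1) :- n := s :- (con (+ 1) :+ n)) refl s (fromℕ n))
        (+-congˡ (-‿cong (sym (1+× n 1#)))))

  -- The bound demanded by  complete  must be exhibited.  When boundedness is
  -- only known up to double negation, it is read off the supremum of the
  -- numbers 1 - x⁻¹, which lie below 1.
  bounded-stable : ∀ S → ∃ S → (∀ x → x ∈ S → 1# ≤ x) → ¬ ¬ ∃ (UpperBound S) → ∃ (UpperBound S)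
  bounded-stable S (x₀ , x₀∈S) S≥1 bounded = (1# - σ) ⁻¹ , bound
    where
    open import Relation.Binary.Reasoning.Setoid setoid
    pos : ∀ {x} → 1# ≤ x → 0# < x
    pos {x} 1≤x = >0-resp (solve 1 (λ x → con (+ 1) :+ (x :- con (+ 1)) := x) refl x) (0<1 ⊕ˢ sub≥0 1≤x)
    inv : ∀ {x} → 0# < x → x * x ⁻¹ ≈ 1#
    inv {x} 0<x = ⁻¹-inverseʳ x (>0⇒≉0 0<x)
    T : Pred Carrier 0ℓ
    T y = ∃ λ x → x ∈ S × (y ≈ 1# - x ⁻¹)
    lub = complete T (1# - x₀ ⁻¹ , x₀ , x₀∈S , refl)
      (1# , λ y y∈T → ≤-respˡ-≈ (sym (proj₂ (proj₂ y∈T)))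
        (≤-by (proj₁ (⁻¹-pos (pos (S≥1 _ (proj₁ (proj₂ y∈T))))))
          (solve 1 (λ i → con (+ 1) :- (con (+ 1) :- i) := i) refl _)))
    σ = proj₁ lub
    0<1-σ : 0# < 1# - σ
    0<1-σ = sub>0 (≰⇒> λ 1≤σ → bounded λ (b , b≥S) →
      let 0<b = pos (≤-trans (S≥1 x₀ x₀∈S) (b≥S x₀ x₀∈S))
          σ≤ : σ ≤ 1# - b ⁻¹
          σ≤ = proj₂ (proj₂ lub) _ λ y y∈T →
            let x   = proj₁ y∈T
                x∈S = proj₁ (proj₂ y∈T)
                0<x = pos (S≥1 x x∈S)
            in ≤-respˡ-≈ (sym (proj₂ (proj₂ y∈T)))
                 (≤-by (sub≥0 (b≥S x x∈S) ⊗ (proj₁ (⁻¹-pos 0<b) ⊗ proj₁ (⁻¹-pos 0<x)))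
                   (begin
                     1# - b ⁻¹ - (1# - x ⁻¹)
                       ≈⟨ solve 2 (λ i j → con (+ 1) :- i :- (con (+ 1) :- j) := con (+ 1) :* j :- con (+ 1) :* i) refl (b ⁻¹) (x ⁻¹) ⟩
                     1# * x ⁻¹ - 1# * b ⁻¹
                       ≈⟨ +-cong (*-congʳ (sym (inv 0<b))) (-‿cong (*-congʳ (sym (inv 0<x)))) ⟩
                     b * b ⁻¹ * x ⁻¹ - x * x ⁻¹ * b ⁻¹
                       ≈⟨ solve 4 (λ b i x j → b :* i :* j :- x :* j :* i := (b :- x) :* (i :* j)) refl b (b ⁻¹) x (x ⁻¹) ⟩
                     (b - x) * (b ⁻¹ * x ⁻¹) ∎))
      in absurd (⁻¹-pos 0<b) (sub≥0 (≤-trans 1≤σ σ≤))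
           (solve 1 (λ i → i :+ (con (+ 1) :- i :- con (+ 1)) := con (+ 0)) refl (b ⁻¹)))
    bound : UpperBound S ((1# - σ) ⁻¹)
    bound x x∈S = ≤-by
        (proj₁ 0<x ⊗ proj₁ (⁻¹-pos 0<1-σ) ⊗ sub≥0 (proj₁ (proj₂ lub) _ (x , x∈S , refl)))
        (begin
          D - x
            ≈⟨ solve 2 (λ D x → D :- x := con (+ 1) :* D :- con (+ 1) :* x) refl D x ⟩
          1# * D - 1# * x
            ≈⟨ +-cong (*-congʳ (sym (inv 0<x))) (-‿cong (*-congʳ (sym (inv 0<1-σ)))) ⟩
          x * x ⁻¹ * D - (1# - σ) * D * x
            ≈⟨ solve 4 (λ D x i σ → x :* i :* D :- (con (+ 1) :- σ) :* D :* x := x :* D :* (σ :- (con (+ 1) :- i))) refl D x (x ⁻¹) σ ⟩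
          x * D * (σ - (1# - x ⁻¹)) ∎)
      where
      D = (1# - σ) ⁻¹
      0<x = pos (S≥1 x x∈S)

  opaque
    cosh-series : ∀ t → ∃ (LeastUpperBound (CoshSums t))
    cosh-series t = complete (CoshSums t) nonempty
      (bounded-stable (CoshSums t) nonempty
        (λ x p → ≤-respʳ-≈ (sym (proj₂ p)) (coshSum-≥1 t (proj₁ p)))
        (λ unbounded → archimedean (t * t) λ (N , t²≤N) → unbounded
          (coshSum t N + coshTerm t N ,
            λ x p → ≤-respˡ-≈ (sym (proj₂ p)) (coshSum-bounded-by t N t²≤N (proj₁ p)))))
      where
      nonempty : ∃ (CoshSums t)
      nonempty = coshSum t 0 , 0 , refl

  -- The sum of the series Σ t²ᵏ/(2k)!, whose terms are all nonnegative.
  cosh : Carrier → Carrier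
  cosh t = proj₁ (cosh-series t)

  coshSum≤cosh : ∀ t n → coshSum t n ≤ cosh t
  coshSum≤cosh t n = proj₁ (proj₂ (cosh-series t)) _ (n , refl)

  cosh-least : ∀ t b → (∀ n → coshSum t n ≤ b) → cosh t ≤ b
  cosh-least t b sums≤b = proj₂ (proj₂ (cosh-series t)) b
    λ x p → ≤-respˡ-≈ (sym (proj₂ p)) (sums≤b (proj₁ p))

  cosh-increasing : Increasing cosh
  cosh-increasing a b 0≤a a≤b = cosh-least a (cosh b) λ n →
    ≤-trans (coshSum-increasing n a b 0≤a a≤b) (coshSum≤cosh b n)

  cosh-nonneg : ∀ t → 0# ≤ cosh t
  cosh-nonneg t = ≤-trans 0≤1 (≤-trans (coshSum-≥1 t 0) (coshSum≤cosh t 0))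

  cosh-convex : Convex cosh
  cosh-convex a b c 0≤a a≤b b≤c = case (c ≟ a)
    where
    d = c - a
    rhs = (c - b) * cosh a + (b - a) * cosh c
    identity : ∀ a b c A C x y z i →
      ((c - b) * A + (b - a) * C) * i - y * ((c - a) * i) ≈
      ((c - b) * x + (b - a) * z - (c - a) * y + (c - b) * (A - x) + (b - a) * (C - z)) * i
    identity = solve 9 (λ a b c A C x y z i →
      ((c :- b) :* A :+ (b :- a) :* C) :* i :- y :* ((c :- a) :* i) :=
      ((c :- b) :* x :+ (b :- a) :* z :- (c :- a) :* y :+ (c :- b) :* (A :- x) :+ (b :- a) :* (C :- z)) :* i) refl
    case : Dec (c ≈ a) → d * cosh b ≤ rhs
    case (yes c≈a) = ≤-trans
        (≤-reflexive (trans (*-congʳ (trans (+-congʳ c≈a) (-‿inverseʳ a))) (zeroˡ _)))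
        (sub≥0 b≤c ⊗ cosh-nonneg a ⊕ sub≥0 a≤b ⊗ cosh-nonneg c)
    case (no c≉a) = ≤-by
        (proj₁ 0<d ⊗ sub≥0 (cosh-least b (rhs * d ⁻¹) λ n →
          ≤-by ((sub≥0 (coshSum-convex n a b c 0≤a a≤b b≤c)
                  ⊕ sub≥0 b≤c ⊗ sub≥0 (coshSum≤cosh a n)
                  ⊕ sub≥0 a≤b ⊗ sub≥0 (coshSum≤cosh c n)) ⊗ proj₁ (⁻¹-pos 0<d))
            (trans (+-congˡ (-‿cong (trans (sym (*-identityʳ _)) (*-congˡ (sym unit)))))
              (identity a b c (cosh a) (cosh c) (coshSum a n) (coshSum b n) (coshSum c n) (d ⁻¹)))))
        (trans (+-congʳ (trans (sym (*-identityʳ rhs)) (*-congˡ (sym unit))))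
          (solve 4 (λ r d i x → r :* (d :* i) :- d :* x := d :* (r :* i :- x)) refl rhs d (d ⁻¹) (cosh b)))
      where
      0<d : 0# < d
      0<d = sub>0 (≤-trans a≤b b≤c , λ a≈c → c≉a (sym a≈c))
      unit = ⁻¹-inverseʳ d (>0⇒≉0 0<d)

  cosh-0≤1 : cosh 0# ≤ 1#
  cosh-0≤1 = cosh-least 0# 1# λ n → ≤-reflexive (sums n)
    where
    vanish : ∀ k → coshTerm 0# (suc k) ≈ 0#
    vanish k = trans (*-congʳ (trans (^-suc 0# k) (zeroˡ _))) (zeroˡ _)
    sums : ∀ n → coshSum 0# n ≈ 1#
    sums zero    = coshTerm-0 0#
    sums (suc n) = trans (+-cong (sums n) (vanish n)) (+-identityʳ 1#)

  cosh-unbounded : ∀ y → 1# ≤ y → y ≤ cosh (y + 1#)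
  cosh-unbounded y 1≤y = ≤-trans
    (≤-by (0≤½ ⊗ sq≥0 y ⊕ 0≤½ ⊕ 0≤1) eq)
    (coshSum≤cosh (y + 1#) 1)
    where
    ½ = fromℕ 2 ⁻¹
    0≤½ : 0# ≤ ½
    0≤½ = proj₁ (⁻¹-pos 0<2)
    eq : coshSum (y + 1#) 1 - y ≈ ½ * (y * y) + ½ + 1#
    eq = trans (+-congʳ (+-congʳ (coshTerm-0 (y + 1#))))
      (trans (solve 2 (λ y h →
          con (+ 1) :+ (y :+ con (+ 1)) :* ((y :+ con (+ 1)) :* con (+ 1)) :* h :- y :=
          (con (+ 1) :+ con (+ 1)) :* h :* y :- y :+ (h :* (y :* y) :+ h :+ con (+ 1))) refl y ½)
        (trans (+-congʳ (+-congʳ (*-congʳ (⁻¹-inverseʳ 2# (>0⇒≉0 0<2)))))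
          (solve 2 (λ y z → con (+ 1) :* y :- y :+ z := z) refl y _)))

  opaque
    arcosh-exists : ∀ y → 1# ≤ y → ∃ λ t → 0# ≤ t × (cosh t ≈ y)
    arcosh-exists y 1≤y = ivt cosh cosh-increasing cosh-convex (cosh-nonneg 0#)
      y (y + 1#) (≤-trans 0≤1 1≤y ⊕ 0≤1) (≤-trans cosh-0≤1 1≤y) (cosh-unbounded y 1≤y)

  -- The value 0 at arguments below 1 is a convention.
  arcosh : Carrier → Carrier
  arcosh y with 1# ≤? y
  ... | yes 1≤y = proj₁ (arcosh-exists y 1≤y)
  ... | no  _   = 0#

module Klein (R : CompleteOrderedField) where

  open Reals R public
  open IntegerCoefficients using (solve; _:=_; _:+_; _:*_; _:-_; con)

  infixl 7 _/_
  _/_ : Carrier → Carrier → Carrier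
  x / y = x * y ⁻¹

  record ℂ : Set where
    constructor _+i_
    field
      re im : Carrier

  infix 4 _≈ᶜ_
  _≈ᶜ_ : Rel ℂ 0ℓ
  (x +i y) ≈ᶜ (x′ +i y′) = x ≈ x′ × y ≈ y′

  -- The set of the two values (x ± iy) / d; both signs are admitted, so that
  -- a set equality between such sets is an equality of unordered pairs.
  [_±i_]/_ : Carrier → Carrier → Carrier → Pred ℂ 0ℓ
  ([ x ±i y ]/ d) z = z ≈ᶜ ((x / d) +i (y / d)) ⊎ z ≈ᶜ ((x / d) +i (- y / d))

  record ℝP² : Set where
    constructor point
    field
      X Y Z   : Carrier
      nonzero : ¬ (X ≈ 0# × Y ≈ 0# × Z ≈ 0#)

  infix 4 _∼_
  _∼_ : Rel ℝP² 0ℓ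
  point x y z _ ∼ point x′ y′ z′ _ =
    ∃ λ k → ¬ (k ≈ 0#) × x ≈ k * x′ × y ≈ k * y′ × z ≈ k * z′

  φ : ℝP² → ℝP²
  φ (point u v w nonzero) = point ((w + u) / 2#) v ((w - u) / 2#) λ (a≈0 , v≈0 , c≈0) →
    nonzero
      ( trans (halves u (solve 3 (λ u w h → (w :+ u) :* h :- (w :- u) :* h := u :* (two :* h)) refl u w (2# ⁻¹)))
          (trans (+-cong a≈0 (-‿cong c≈0)) (-‿inverseʳ 0#))
      , v≈0
      , trans (halves w (solve 3 (λ u w h → (w :+ u) :* h :+ (w :- u) :* h := w :* (two :* h)) refl u w (2# ⁻¹)))
          (trans (+-cong a≈0 c≈0) (+-identityʳ 0#)) )
    where
    two = λ {n} → con {n} (+ 1) :+ con (+ 1)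
    halves : ∀ x {y} → y ≈ x * (2# * 2# ⁻¹) → x ≈ y
    halves x eq = sym (trans eq (trans (*-congˡ (⁻¹-inverseʳ 2# (>0⇒≉0 0<2))) (*-identityʳ x)))

  NegativeDiscriminant : Pred ℝP² 0ℓ
  NegativeDiscriminant (point a b c _) = b * b < 4# * a * c

  -- Meant for b² < 4ac, where a is nonzero and √ is applied to a positive number.
  quadraticFormula : ℝP² → Pred ℂ 0ℓ
  quadraticFormula (point a b c _) = [ - b ±i √ (4# * a * c - b * b) ]/ (2# * a)

  record KleinDisk : Set where
    constructor disk
    field
      u v    : Carrier
      inside : u * u + v * v < 1#

  infix 4 _≈ᴷ_
  _≈ᴷ_ : Rel KleinDisk 0ℓ
  disk u v _ ≈ᴷ disk u′ v′ _ = u ≈ u′ × v ≈ v′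

  -- On the disk the argument of arcosh is at least 1, so neither convention
  -- for √ or arcosh outside its domain is ever used.
  dᴷ : KleinDisk → KleinDisk → Carrier
  dᴷ (disk u₁ v₁ _) (disk u₂ v₂ _) = arcosh
    ((1# - u₁ * u₂ - v₁ * v₂) / √ ((1# - u₁ * u₁ - v₁ * v₁) * (1# - u₂ * u₂ - v₂ * v₂)))

  [_] : KleinDisk → ℝP²
  [ disk u v _ ] = point u v 1# λ (_ , _ , 1≈0) → 0≉1 (sym 1≈0)

  InKleinDisk : Pred ℝP² 0ℓ
  InKleinDisk p = ∃ λ k → p ∼ [ k ]

  kleinFormula : KleinDisk → Pred ℂ 0ℓ
  kleinFormula (disk u v _) = [ - v ±i √ (1# - u * u - v * v) ]/ (1# + u)

  record UpperHalfPlane : Set where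
    constructor upper
    field
      x y : Carrier
      y>0 : 0# < y

  infix 4 _≈ᴴ_
  _≈ᴴ_ : Rel UpperHalfPlane 0ℓ
  upper x y _ ≈ᴴ upper x′ y′ _ = x ≈ x′ × y ≈ y′

  dᴴ : UpperHalfPlane → UpperHalfPlane → Carrier
  dᴴ (upper x₁ y₁ _) (upper x₂ y₂ _) = arcosh
    (1# + ((x₂ - x₁) * (x₂ - x₁) + (y₂ - y₁) * (y₂ - y₁)) / (2# * y₁ * y₂))

  toℂ : UpperHalfPlane → ℂ
  toℂ (upper x y _) = x +i y

  IsIsometry : (KleinDisk → UpperHalfPlane) → Set
  IsIsometry f = IsBijection _≈ᴷ_ _≈ᴴ_ f × (∀ p q → dᴴ (f p) (f q) ≈ dᴷ p q)

{-# OPTIONS --safe #-}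
module Submission where

-- Both metrics are arcosh of an algebraic expression.  If (u , v) is sent to
-- x + iy and e = 1 + u, then e x = - v, e y = √ (1 - u² - v²) and
-- e (x² + y²) = 1 - u, so after multiplication by e₁ e₂ the two arguments of
-- arcosh coincide.  The same relations give e (1 + x² + y²) = 2, which recovers
-- (u , v) from x + iy.  For the quadratic formula, scaling [a:b:c] by m scales
-- √ (4ac - b²) by ∣m∣, which at worst swaps the two roots.

open import Defs
open import Data.Product.Base using (_×_; ∃; _,_; proj₁; proj₂)
open import Data.Sum.Base as Sum using (_⊎_; inj₁; inj₂)
open import Data.Empty using (⊥-elim)
open import Data.Integer.Base using (+_)
open import Data.Nat.Base using (zero; suc)
open import Function.Base using (_∘_)
open import Function.Bundles using (_⇔_; mk⇔)
open import Function.Structures using (IsBijection)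
open import Relation.Binary.Structures using (IsEquivalence)
open import Relation.Nullary using (¬_; yes; no)
open import Relation.Unary using (_∈_; _≐_)

module _ (R : CompleteOrderedField) where

  open Klein R
  open IntegerCoefficients using (solve; _:=_; _:+_; _:*_; _:-_; :-_; con)

  -- An equation that follows from others is proved by exhibiting the difference
  -- of its sides as a linear combination of the differences of theirs.

  infixl 6 _⊕⁰_
  infixr 7 _⊗⁰_

  _⊕⁰_ : ∀ {x y} → x ≈ 0# → y ≈ 0# → x + y ≈ 0#
  p ⊕⁰ q = trans (+-cong p q) (+-identityˡ 0#)

  _⊗⁰_ : ∀ c {x} → x ≈ 0# → c * x ≈ 0#
  c ⊗⁰ p = trans (*-congˡ p) (zeroʳ c)

  sub≈0 : ∀ {p q} → p ≈ q → p - q ≈ 0#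
  sub≈0 p≈q = trans (+-congʳ p≈q) (-‿inverseʳ _)

  ≈-by : ∀ {p q e} → e ≈ 0# → p - q ≈ e → p ≈ q
  ≈-by {p} {q} e≈0 p-q≈e = trans
    (solve 2 (λ p q → p := (p :- q) :+ q) refl p q)
    (trans (+-congʳ (trans p-q≈e e≈0)) (+-identityˡ q))

  -- Inverses and quotients.

  2≉0 : ¬ (2# ≈ 0#)
  2≉0 = >0⇒≉0 0<2

  *-≉0 : ∀ {x y} → ¬ (x ≈ 0#) → ¬ (y ≈ 0#) → ¬ (x * y ≈ 0#)
  *-≉0 x≉0 y≉0 xy≈0 = x≉0 (*-cancel-≉0 y≉0 xy≈0)

  inverse-≈0 : ∀ {x} → ¬ (x ≈ 0#) → x * x ⁻¹ - 1# ≈ 0#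
  inverse-≈0 x≉0 = sub≈0 (⁻¹-inverseʳ _ x≉0)

  ⁻¹-≉0 : ∀ {x} → ¬ (x ≈ 0#) → ¬ (x ⁻¹ ≈ 0#)
  ⁻¹-≉0 {x} x≉0 i≈0 = 0≉1 (trans (sym (x ⊗⁰ i≈0)) (⁻¹-inverseʳ x x≉0))

  sq>0 : ∀ {x} → ¬ (x ≈ 0#) → 0# < x * x
  sq>0 x≉0 = sq≥0 _ , λ 0≈xx → *-≉0 x≉0 x≉0 (sym 0≈xx)

  /-unique : ∀ {x d q} → ¬ (d ≈ 0#) → q * d ≈ x → q ≈ x / d
  /-unique {x} {d} {q} d≉0 qd≈x = ≈-by
    (d ⁻¹ ⊗⁰ sub≈0 qd≈x ⊕⁰ (- q) ⊗⁰ inverse-≈0 d≉0)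
    (solve 4 (λ x d i q → q :- x :* i := i :* (q :* d :- x) :+ (:- q) :* (d :* i :- con (+ 1)))
      refl x d (d ⁻¹) q)

  /-*-cancel : ∀ x {d} → ¬ (d ≈ 0#) → x / d * d ≈ x
  /-*-cancel x {d} d≉0 = ≈-by (x ⊗⁰ inverse-≈0 d≉0)
    (solve 3 (λ x d i → x :* i :* d :- x := x :* (d :* i :- con (+ 1))) refl x d (d ⁻¹))

  /-scale : ∀ m {x d x′ d′} → ¬ (d ≈ 0#) → ¬ (d′ ≈ 0#) →
            d ≈ m * d′ → x ≈ m * x′ → x′ / d′ ≈ x / d
  /-scale m {x} {d} {x′} {d′} d≉0 d′≉0 d≈md′ x≈mx′ = /-unique d≉0 (≈-by
    ((x′ / d′) ⊗⁰ sub≈0 d≈md′ ⊕⁰ m ⊗⁰ sub≈0 (/-*-cancel x′ d′≉0) ⊕⁰ (- 1#) ⊗⁰ sub≈0 x≈mx′)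
    (solve 6 (λ q m x d x′ d′ → q :* d :- x :=
        q :* (d :- m :* d′) :+ m :* (q :* d′ :- x′) :+ (:- con (+ 1)) :* (x :- m :* x′))
      refl (x′ / d′) m x d x′ d′))

  /-cong : ∀ {x d x′ d′} → ¬ (d ≈ 0#) → d ≈ d′ → x ≈ x′ → x / d ≈ x′ / d′
  /-cong d≉0 d≈d′ x≈x′ = /-unique (λ d′≈0 → d≉0 (trans d≈d′ d′≈0))
    (trans (*-congˡ (sym d≈d′)) (trans (/-*-cancel _ d≉0) x≈x′))

  -- Injectivity on the nonnegative elements, and square roots.

  strictly-increasing⇒injective : (f : Carrier → Carrier) →
    (∀ a b → 0# ≤ a → a < b → ¬ (f a ≈ f b)) →
    ∀ {a b} → 0# ≤ a → 0# ≤ b → f a ≈ f b → a ≈ b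
  strictly-increasing⇒injective f strict {a} {b} 0≤a 0≤b fa≈fb with a ≟ b | total a b
  ... | yes a≈b | _        = a≈b
  ... | no  a≉b | inj₁ a≤b = ⊥-elim (strict a b 0≤a (a≤b , a≉b) fa≈fb)
  ... | no  a≉b | inj₂ b≤a = ⊥-elim (strict b a 0≤b (b≤a , λ b≈a → a≉b (sym b≈a)) (sym fa≈fb))

  square-injective : ∀ {a b} → 0# ≤ a → 0# ≤ b → a * a ≈ b * b → a ≈ b
  square-injective = strictly-increasing⇒injective (λ t → t * t) λ a b 0≤a a<b aa≈bb →
    -- The positive square (b - a)² and the nonnegative 2a(b - a) add up to b² - a², which the
    -- assumption makes 0.
    absurd (sub>0 a<b ⊗ˢ sub>0 a<b) ((0≤a ⊕ 0≤a) ⊗ proj₁ (sub>0 a<b))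
      (trans (solve 2 (λ a b → (b :- a) :* (b :- a) :+ (a :+ a) :* (b :- a) := b :* b :- a :* a) refl a b)
        (sub≈0 (sym aa≈bb)))

  √-nonneg : ∀ x → 0# ≤ √ x
  √-nonneg x with 0# ≤? x
  ... | yes 0≤x = proj₁ (proj₂ (sqrt-exists x 0≤x))
  ... | no  _   = ≤-refl

  √-square : ∀ {x} → 0# ≤ x → √ x * √ x ≈ x
  √-square {x} 0≤x with 0# ≤? x
  ... | yes p   = proj₂ (proj₂ (sqrt-exists x p))
  ... | no  0≰x = ⊥-elim (0≰x 0≤x)

  -- Being a square, `x` is nonnegative, so the default value of `√` does not arise.
  √-unique : ∀ {x s} → 0# ≤ s → s * s ≈ x → √ x ≈ s
  √-unique 0≤s ss≈x = square-injective (√-nonneg _) 0≤s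
    (trans (√-square (≥0-resp ss≈x (sq≥0 _))) (sym ss≈x))

  -- The root is a witness obtained from a proof of nonnegativity, so it is not visibly compatible
  -- with `_≈_`; uniqueness supplies this.
  √-cong : ∀ {x y} → 0# ≤ x → x ≈ y → √ x ≈ √ y
  √-cong 0≤x x≈y = sym (√-unique (√-nonneg _) (trans (√-square 0≤x) x≈y))

  √-* : ∀ {x y} → 0# ≤ x → 0# ≤ y → √ (x * y) ≈ √ x * √ y
  √-* {x} {y} 0≤x 0≤y = √-unique (√-nonneg x ⊗ √-nonneg y)
    (trans (solve 2 (λ s t → s :* t :* (s :* t) := s :* s :* (t :* t)) refl (√ x) (√ y))
      (*-cong (√-square 0≤x) (√-square 0≤y)))

  √-pos : ∀ {x} → 0# < x → 0# < √ x
  √-pos 0<x = √-nonneg _ , λ 0≈s → proj₂ 0<x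
    (trans (sym (_ ⊗⁰ sym 0≈s)) (√-square (proj₁ 0<x)))

  -- Injectivity of `cosh` and congruence of `arcosh`.

  -- Already the quadratic term of the series separates cosh a from cosh b.

  coshSum-gap : ∀ {a b} → 0# ≤ a → a ≤ b → ∀ n →
    coshSum a (suc n) + (coshTerm b 1 - coshTerm a 1) ≤ coshSum b (suc n)
  coshSum-gap {a} {b} 0≤a a≤b zero = ≤-by (sub≥0 (coshSum-increasing 0 a b 0≤a a≤b))
    (solve 4 (λ p q x y → q :+ y :- (p :+ x :+ (y :- x)) := q :- p) refl _ _ _ _)
  coshSum-gap {a} {b} 0≤a a≤b (suc n) = ≤-by
    (sub≥0 (coshSum-gap 0≤a a≤b n) ⊕ sub≥0 (coshTerm-increasing (suc (suc n)) a b 0≤a a≤b))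
    (solve 5 (λ p q x y d → q :+ y :- (p :+ x :+ d) := q :- (p :+ d) :+ (y :- x)) refl
      (coshSum a (suc n)) (coshSum b (suc n)) (coshTerm a (suc (suc n))) (coshTerm b (suc (suc n))) _)

  -- The gap between partial sums passes to the supremum. The sum up to `n` is first enlarged to the
  -- one up to `suc n`, because the gap appears only once the term of index 1 is included.
  cosh-gap : ∀ {a b} → 0# ≤ a → a ≤ b → cosh a ≤ cosh b - (coshTerm b 1 - coshTerm a 1)
  cosh-gap {a} {b} 0≤a a≤b = cosh-least a _ λ n → ≤-by
    (coshTerm-nonneg a (suc n) ⊕ sub≥0 (coshSum-gap 0≤a a≤b n) ⊕ sub≥0 (coshSum≤cosh b (suc n)))
    (solve 5 (λ p x d q c → c :- d :- p := x :+ (q :- (p :+ x :+ d)) :+ (c :- q)) refl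
      (coshSum a n) (coshTerm a (suc n)) _ (coshSum b (suc n)) (cosh b))

  coshTerm-1-injective : ∀ {a b} → 0# ≤ a → 0# ≤ b → coshTerm a 1 ≈ coshTerm b 1 → a ≈ b
  coshTerm-1-injective {a} {b} 0≤a 0≤b eq = square-injective 0≤a 0≤b (≈-by
    (*-cancel-≉0 (>0⇒≉0 (fact⁻¹-pos 1))
      (trans (solve 3 (λ a b i → (a :* a :- b :* b) :* i :=
                a :* (a :* con (+ 1)) :* i :- b :* (b :* con (+ 1)) :* i) refl a b _)
        (sub≈0 eq)))
    refl)

  cosh-injective : ∀ {a b} → 0# ≤ a → 0# ≤ b → cosh a ≈ cosh b → a ≈ b
  cosh-injective = strictly-increasing⇒injective cosh λ a b 0≤a a<b ca≈cb →
    let a≤b = proj₁ a<b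
        0≤b = ≤-trans 0≤a a≤b
    in absurd
      (sub>0 (coshTerm-increasing 1 a b 0≤a a≤b , λ eq → proj₂ a<b (coshTerm-1-injective 0≤a 0≤b eq)))
      (sub≥0 (cosh-gap 0≤a a≤b))
      (trans (solve 3 (λ d p q → d :+ (q :- d :- p) := q :- p) refl _ (cosh a) (cosh b))
        (sub≈0 (sym ca≈cb)))

  -- Above 1 both values are nonnegative preimages under `cosh`, hence equal by injectivity; below 1
  -- both are the default value. The isometry thereby reduces to an identity between arguments of
  -- `arcosh`.
  arcosh-cong : ∀ {x y} → x ≈ y → arcosh x ≈ arcosh y
  arcosh-cong {x} {y} x≈y with 1# ≤? x | 1# ≤? y
  ... | no  _   | no  _   = refl
  ... | yes 1≤x | no  1≰y = ⊥-elim (1≰y (≤-respʳ-≈ x≈y 1≤x))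
  ... | no  1≰x | yes 1≤y = ⊥-elim (1≰x (≤-respʳ-≈ (sym x≈y) 1≤y))
  ... | yes 1≤x | yes 1≤y =
    let (_ , 0≤s , cs≈x) = arcosh-exists x 1≤x
        (_ , 0≤t , ct≈y) = arcosh-exists y 1≤y
    in cosh-injective 0≤s 0≤t (trans cs≈x (trans x≈y (sym ct≈y)))

  -- The projective change of coordinates

  ∼-isEquivalence : IsEquivalence _∼_
  ∼-isEquivalence = record
    { refl  = 1# , (λ 1≈0 → 0≉1 (sym 1≈0)) , one , one , one
    ; sym   = λ (k , k≉0 , ex , ey , ez) →
        k ⁻¹ , ⁻¹-≉0 k≉0 , invert k≉0 ex , invert k≉0 ey , invert k≉0 ez
    ; trans = λ (k , k≉0 , ex , ey , ez) (l , l≉0 , fx , fy , fz) →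
        k * l , *-≉0 k≉0 l≉0 , compose ex fx , compose ey fy , compose ez fz
    }
    where
    one : ∀ {x} → x ≈ 1# * x
    one = sym (*-identityˡ _)
    invert : ∀ {k x y} → ¬ (k ≈ 0#) → x ≈ k * y → y ≈ k ⁻¹ * x
    invert {k} {x} {y} k≉0 x≈ky = ≈-by
      ((- (k ⁻¹)) ⊗⁰ sub≈0 x≈ky ⊕⁰ (- y) ⊗⁰ inverse-≈0 k≉0)
      (solve 4 (λ k i x y → y :- i :* x := (:- i) :* (x :- k :* y) :+ (:- y) :* (k :* i :- con (+ 1)))
        refl k (k ⁻¹) x y)
    compose : ∀ {k l x y z} → x ≈ k * y → y ≈ l * z → x ≈ k * l * z
    compose x≈ky y≈lz = trans x≈ky (trans (*-congˡ y≈lz) (sym (*-assoc _ _ _)))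

  -- The ring solver treats the inverse of 2 as an atom, so identities that depend on 2 · 2⁻¹ = 1
  -- carry a multiple of this equation.
  half-≈0 : 2# * 2# ⁻¹ - 1# ≈ 0#
  half-≈0 = inverse-≈0 2≉0

  φ-cong : ∀ {p q} → p ∼ q → φ p ∼ φ q
  φ-cong {point u v w _} {point u′ v′ w′ _} (k , k≉0 , eu , ev , ew) =
    k , k≉0 ,
    ≈-by (½ ⊗⁰ sub≈0 ew ⊕⁰ ½ ⊗⁰ sub≈0 eu)
      (solve 6 (λ u w u′ w′ k h → (w :+ u) :* h :- k :* ((w′ :+ u′) :* h) :=
          h :* (w :- k :* w′) :+ h :* (u :- k :* u′)) refl u w u′ w′ k ½) ,
    ev ,
    ≈-by (½ ⊗⁰ sub≈0 ew ⊕⁰ (- ½) ⊗⁰ sub≈0 eu)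
      (solve 6 (λ u w u′ w′ k h → (w :- u) :* h :- k :* ((w′ :- u′) :* h) :=
          h :* (w :- k :* w′) :+ (:- h) :* (u :- k :* u′)) refl u w u′ w′ k ½)
    where ½ = 2# ⁻¹

  φ-injective : ∀ {p q} → φ p ∼ φ q → p ∼ q
  φ-injective {point u v w _} {point u′ v′ w′ _} (k , k≉0 , ea , eb , ec) =
    k , k≉0 ,
    -- With a = (w + u)/2 and c = (w - u)/2, u is a - c; below, w is a + c.
    ≈-by (1# ⊗⁰ sub≈0 ea ⊕⁰ (- 1#) ⊗⁰ sub≈0 ec ⊕⁰ (k * u′ - u) ⊗⁰ half-≈0)
      (solve 6 (λ u w u′ w′ k h → u :- k :* u′ :=
          con (+ 1) :* ((w :+ u) :* h :- k :* ((w′ :+ u′) :* h))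
          :+ (:- con (+ 1)) :* ((w :- u) :* h :- k :* ((w′ :- u′) :* h))
          :+ (k :* u′ :- u) :* (con (+ 2) :* h :- con (+ 1))) refl u w u′ w′ k (2# ⁻¹)) ,
    eb ,
    ≈-by (1# ⊗⁰ sub≈0 ea ⊕⁰ 1# ⊗⁰ sub≈0 ec ⊕⁰ (k * w′ - w) ⊗⁰ half-≈0)
      (solve 6 (λ u w u′ w′ k h → w :- k :* w′ :=
          con (+ 1) :* ((w :+ u) :* h :- k :* ((w′ :+ u′) :* h))
          :+ con (+ 1) :* ((w :- u) :* h :- k :* ((w′ :- u′) :* h))
          :+ (k :* w′ :- w) :* (con (+ 2) :* h :- con (+ 1))) refl u w u′ w′ k (2# ⁻¹))

  φ⁻¹ : ℝP² → ℝP²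
  φ⁻¹ (point a b c nonzero) = point (a - c) b (a + c) λ (u≈0 , b≈0 , w≈0) → nonzero
    ( ≈-by (½ ⊗⁰ u≈0 ⊕⁰ ½ ⊗⁰ w≈0 ⊕⁰ (- a) ⊗⁰ half-≈0)
        (solve 3 (λ a c h → a :- con (+ 0) := h :* (a :- c) :+ h :* (a :+ c)
            :+ (:- a) :* (con (+ 2) :* h :- con (+ 1))) refl a c ½)
    , b≈0
    , ≈-by ((- ½) ⊗⁰ u≈0 ⊕⁰ ½ ⊗⁰ w≈0 ⊕⁰ (- c) ⊗⁰ half-≈0)
        (solve 3 (λ a c h → c :- con (+ 0) := (:- h) :* (a :- c) :+ h :* (a :+ c)
            :+ (:- c) :* (con (+ 2) :* h :- con (+ 1))) refl a c ½) )
    where ½ = 2# ⁻¹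

  φ-φ⁻¹ : ∀ p → φ (φ⁻¹ p) ∼ p
  φ-φ⁻¹ (point a b c _) =
    1# , (λ 1≈0 → 0≉1 (sym 1≈0)) ,
    ≈-by (a ⊗⁰ half-≈0)
      (solve 3 (λ a c h → (a :+ c :+ (a :- c)) :* h :- con (+ 1) :* a :=
          a :* (con (+ 2) :* h :- con (+ 1))) refl a c (2# ⁻¹)) ,
    sym (*-identityˡ b) ,
    ≈-by (c ⊗⁰ half-≈0)
      (solve 3 (λ a c h → (a :+ c :- (a :- c)) :* h :- con (+ 1) :* c :=
          c :* (con (+ 2) :* h :- con (+ 1))) refl a c (2# ⁻¹))

  φ-isBijection : IsBijection _∼_ _∼_ φ
  φ-isBijection = record
    { isInjection = record
      { isCongruent = record
        { cong           = λ {p} {q} → φ-cong {p} {q}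
        ; isEquivalence₁ = ∼-isEquivalence
        ; isEquivalence₂ = ∼-isEquivalence
        }
      ; injective = λ {p} {q} → φ-injective {p} {q}
      }
    ; surjective = λ q → φ⁻¹ q , λ {p} p∼ →
        IsEquivalence.trans ∼-isEquivalence {φ p} {φ (φ⁻¹ q)} {q} (φ-cong {p} {φ⁻¹ q} p∼) (φ-φ⁻¹ q)
    }

  -- The product 4ac is the factored difference of squares (w + u)(w - u), so the discriminant conic
  -- pulls back to the unit circle in homogeneous form.
  φ-discriminant : ∀ u v w →
    4# * ((w + u) / 2#) * ((w - u) / 2#) - v * v ≈ w * w - u * u - v * v
  φ-discriminant u v w = ≈-by
    (((w * w - u * u) * (2# * 2# ⁻¹ + 1#)) ⊗⁰ half-≈0)
    (solve 4 (λ u v w h →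
        let one = con (+ 1) ; two = one :+ one in
        (two :+ two) :* ((w :+ u) :* h) :* ((w :- u) :* h) :- v :* v :- (w :* w :- u :* u :- v :* v) :=
        (w :* w :- u :* u) :* (two :* h :+ one) :* (two :* h :- one))
      refl u v w (2# ⁻¹))

  -- The form w² - u² - v² is homogeneous of degree two: its value at k(u′, v′, 1) is k²(1 - u′² -
  -- v′²), positive whatever the sign of `k`.
  klein⇒negative : ∀ p → p ∈ InKleinDisk → φ p ∈ NegativeDiscriminant
  klein⇒negative (point u v w _) (disk u′ v′ inside , k , k≉0 , eu , ev , ew) =
    <-by (sq>0 k≉0 ⊗ˢ sub>0 inside) (trans (φ-discriminant u v w) (≈-by
      ((w + k) ⊗⁰ sub≈0 ew ⊕⁰ (- (u + k * u′)) ⊗⁰ sub≈0 eu ⊕⁰ (- (v + k * v′)) ⊗⁰ sub≈0 ev)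
      (solve 6 (λ u v w k u′ v′ →
          w :* w :- u :* u :- v :* v :- k :* k :* (con (+ 1) :- (u′ :* u′ :+ v′ :* v′)) :=
          (w :+ k) :* (w :- k :* con (+ 1)) :+ (:- (u :+ k :* u′)) :* (u :- k :* u′)
            :+ (:- (v :+ k :* v′)) :* (v :- k :* v′))
        refl u v w k u′ v′)))

  negative⇒klein : ∀ p → φ p ∈ NegativeDiscriminant → p ∈ InKleinDisk
  negative⇒klein (point u v w _) negative =
    disk (u / w) (v / w) inside , w , w≉0 , multiple u , multiple v , sym (*-identityʳ w)
    where
    positive : 0# < w * w - u * u - v * v
    positive = >0-resp (φ-discriminant u v w) (sub>0 negative)
    w≉0 : ¬ (w ≈ 0#)
    -- Adding u² + v² to the positive form leaves w², which would be 0.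
    w≉0 w≈0 = absurd positive (sq≥0 u ⊕ sq≥0 v)
      (trans (solve 3 (λ u v w → w :* w :- u :* u :- v :* v :+ (u :* u :+ v :* v) := w :* w) refl u v w)
        (w ⊗⁰ w≈0))
    multiple : ∀ x → x ≈ w * (x / w)
    multiple x = trans (sym (/-*-cancel x w≉0)) (*-comm _ w)
    inside : u / w * (u / w) + v / w * (v / w) < 1#
    inside = <-by (positive ⊗ˢ sq>0 (⁻¹-≉0 w≉0)) (≈-by
      ((- (w * w ⁻¹ + 1#)) ⊗⁰ inverse-≈0 w≉0)
      (solve 4 (λ u v w i →
          con (+ 1) :- (u :* i :* (u :* i) :+ v :* i :* (v :* i))
            :- (w :* w :- u :* u :- v :* v) :* (i :* i) :=
          (:- (w :* i :+ con (+ 1))) :* (w :* i :- con (+ 1)))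
        refl u v w (w ⁻¹)))

  -- The quadratic formula

  height² : KleinDisk → Carrier
  height² (disk u v _) = 1# - u * u - v * v

  height²-pos : ∀ k → 0# < height² k
  height²-pos (disk u v inside) = >0-resp
    (solve 2 (λ u v → con (+ 1) :- (u :* u :+ v :* v) := con (+ 1) :- u :* u :- v :* v) refl u v)
    (sub>0 inside)

  -- Since 1 - u² - v² = 2(1 + u) - (1 + u)² - v², positivity of the left side forces 1 + u > 0.
  1+u-pos : ∀ k → 0# < 1# + KleinDisk.u k
  1+u-pos k@(disk u v _) = ≰⇒> λ 1+u≤0 → absurd (height²-pos k)
    (sq≥0 (1# + u) ⊕ sq≥0 v ⊕ proj₁ 0<2 ⊗ sub≥0 1+u≤0)
    (solve 2 (λ u v → con (+ 1) :- u :* u :- v :* v :+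
        ((con (+ 1) :+ u) :* (con (+ 1) :+ u) :+ v :* v
          :+ (con (+ 1) :+ con (+ 1)) :* (con (+ 0) :- (con (+ 1) :+ u))) := con (+ 0)) refl u v)

  1+u≉0 : ∀ k → ¬ (1# + KleinDisk.u k ≈ 0#)
  1+u≉0 k = >0⇒≉0 (1+u-pos k)

  -- The second alternative for `y` serves negative `m`: the + root on one side is then the - root
  -- on the other.
  roots-scale : ∀ m {x y d x′ y′ d′} → ¬ (d ≈ 0#) → ¬ (d′ ≈ 0#) →
    d ≈ m * d′ → x ≈ m * x′ → y ≈ m * y′ ⊎ y ≈ m * (- y′) →
    ([ x ±i y ]/ d) ≐ ([ x′ ±i y′ ]/ d′)
  roots-scale m {x} {y} {d} {x′} {y′} {d′} d≉0 d′≉0 ed ex (inj₁ ey) =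
    Sum.map (λ (p , q) → trans p (sym re) , trans q (sym im₊))
            (λ (p , q) → trans p (sym re) , trans q (sym im₋)) ,
    Sum.map (λ (p , q) → trans p re , trans q im₊) (λ (p , q) → trans p re , trans q im₋)
    where
    re  = /-scale m d≉0 d′≉0 ed ex
    im₊ = /-scale m d≉0 d′≉0 ed ey
    im₋ : (- y′) / d′ ≈ (- y) / d
    im₋ = /-scale m d≉0 d′≉0 ed
      (trans (-‿cong ey) (solve 2 (λ m y → :- (m :* y) := m :* (:- y)) refl m y′))
  roots-scale m {x} {y} {d} {x′} {y′} {d′} d≉0 d′≉0 ed ex (inj₂ ey) =
    Sum.swap ∘ Sum.map (λ (p , q) → trans p (sym re) , trans q (sym im₊))
                       (λ (p , q) → trans p (sym re) , trans q (sym im₋)) ,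
    Sum.swap ∘ Sum.map (λ (p , q) → trans p re , trans q im₋) (λ (p , q) → trans p re , trans q im₊)
    where
    re  = /-scale m d≉0 d′≉0 ed ex
    im₊ = /-scale m d≉0 d′≉0 ed ey
    im₋ : y′ / d′ ≈ (- y) / d
    im₋ = /-scale m d≉0 d′≉0 ed
      (trans (-‿cong ey) (solve 2 (λ m y → :- (m :* (:- y)) := m :* y) refl m y′))

  -- For any representative, a = m(1 + u)/2, b = mv and c = m(1 - u)/2, so numerator and denominator
  -- are both multiplied by `m`, up to the sign of the root.
  quadratic≐klein : ∀ k q → q ∼ φ [ k ] → quadraticFormula q ≐ kleinFormula k
  quadratic≐klein k@(disk u v _) (point a b c _) (m , m≉0 , ea , eb , ec) =
    roots-scale m (λ 2a≈0 → *-≉0 m≉0 (1+u≉0 k) (trans (sym 2a≈) 2a≈0)) (1+u≉0 k) 2a≈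
      (trans (-‿cong eb) (solve 2 (λ m v → :- (m :* v) := m :* (:- v)) refl m v))
      (Sum.map positive negative (total 0# m))
    where
    ½ = 2# ⁻¹
    s = √ (height² k)
    2a≈ : 2# * a ≈ m * (1# + u)
    2a≈ = ≈-by (2# ⊗⁰ sub≈0 ea ⊕⁰ (m * (1# + u)) ⊗⁰ half-≈0)
      (solve 4 (λ a m u h → con (+ 2) :* a :- m :* (con (+ 1) :+ u) :=
          con (+ 2) :* (a :- m :* ((con (+ 1) :+ u) :* h))
          :+ m :* (con (+ 1) :+ u) :* (con (+ 2) :* h :- con (+ 1))) refl a m u ½)
    -- This fixes the root up to sign; whichever of m s and m(- s) is nonnegative is selected by
    -- `√-unique`.
    disc : m * s * (m * s) ≈ 4# * a * c - b * b
    disc = ≈-by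
      ((m * m) ⊗⁰ sub≈0 (√-square (proj₁ (height²-pos k)))
        ⊕⁰ (- (m * m)) ⊗⁰ sub≈0 (φ-discriminant u v 1#)
        ⊕⁰ (- (4# * c)) ⊗⁰ sub≈0 ea
        ⊕⁰ (- (4# * (m * ((1# + u) / 2#)))) ⊗⁰ sub≈0 ec
        ⊕⁰ (b + m * v) ⊗⁰ sub≈0 eb)
      (solve 8 (λ a b c m u v s h →
        let one = con (+ 1) ; two = one :+ one ; four = two :+ two
            A = (one :+ u) :* h ; C = (one :- u) :* h in
        m :* s :* (m :* s) :- (four :* a :* c :- b :* b) :=
        m :* m :* (s :* s :- (one :- u :* u :- v :* v))
        :+ (:- (m :* m)) :* (four :* A :* C :- v :* v :- (one :* one :- u :* u :- v :* v))
        :+ (:- (four :* c)) :* (a :- m :* A)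
        :+ (:- (four :* (m :* A))) :* (c :- m :* C)
        :+ (b :+ m :* v) :* (b :- m :* v)) refl a b c m u v s ½)
    positive : 0# ≤ m → √ (4# * a * c - b * b) ≈ m * s
    positive 0≤m = √-unique (0≤m ⊗ √-nonneg _) disc
    negative : m ≤ 0# → √ (4# * a * c - b * b) ≈ m * (- s)
    negative m≤0 = √-unique
      (≥0-resp (solve 2 (λ m s → (con (+ 0) :- m) :* s := m :* (:- s)) refl m s) (sub≥0 m≤0 ⊗ √-nonneg _))
      (trans (solve 2 (λ m s → m :* (:- s) :* (m :* (:- s)) := m :* s :* (m :* s)) refl m s) disc)

  -- The isometry

  toUpper : KleinDisk → UpperHalfPlane
  toUpper k@(disk u v _) = upper ((- v) / (1# + u)) (√ (height² k) / (1# + u))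
    (√-pos (height²-pos k) ⊗ˢ ⁻¹-pos (1+u-pos k))

  module ToUpper (k : KleinDisk) where
    open KleinDisk k public using (u; v)
    open UpperHalfPlane (toUpper k) public using (x; y; y>0)

    s e r : Carrier
    s = √ (height² k)
    e = 1# + u
    r = x * x + y * y

    xe : x * e ≈ - v
    xe = /-*-cancel (- v) (1+u≉0 k)

    ye : y * e ≈ s
    ye = /-*-cancel s (1+u≉0 k)

    -- One more factor `e` gives r e² = v² + s² = 1 - u² = (1 - u) e, and `e` cancels.
    re : r * e ≈ 1# - u
    re = ≈-by (*-cancel-≉0 (1+u≉0 k) (trans
      (solve 5 (λ u v x y s →
        let one = con (+ 1) ; e = one :+ u in
        ((x :* x :+ y :* y) :* e :- (one :- u)) :* e :=
        (x :* e :- v) :* (x :* e :- :- v) :+ (y :* e :+ s) :* (y :* e :- s)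
        :+ one :* (s :* s :- (one :- u :* u :- v :* v))) refl u v x y s)
      ((x * e - v) ⊗⁰ sub≈0 xe ⊕⁰ (y * e + s) ⊗⁰ sub≈0 ye
        ⊕⁰ 1# ⊗⁰ sub≈0 (√-square (proj₁ (height²-pos k)))))) refl

  isometry : ∀ p q → dᴴ (toUpper p) (toUpper q) ≈ dᴷ p q
  isometry p q = arcosh-cong (/-unique (>0⇒≉0 (√-pos (height²-pos p ⊗ˢ height²-pos q)))
      (trans (*-congˡ (√-* (proj₁ (height²-pos p)) (proj₁ (height²-pos q)))) (≈-by doubled refl)))
    where
    module P = ToUpper p
    module Q = ToUpper q
    W = (Q.x - P.x) * (Q.x - P.x) + (Q.y - P.y) * (Q.y - P.y)
    δ = W / (2# * P.y * Q.y)
    N = 1# - P.u * Q.u - P.v * Q.v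

    δ-def : δ * (2# * P.y * Q.y) ≈ W
    δ-def = /-*-cancel W (>0⇒≉0 (0<2 ⊗ˢ P.y>0 ⊗ˢ Q.y>0))

    heights : 2# * (P.s * Q.s) ≈ 2# * P.y * Q.y * (P.e * Q.e)
    heights = trans (*-congˡ (*-cong (sym P.ye) (sym Q.ye)))
      (solve 5 (λ t y e y′ e′ → t :* (y :* e :* (y′ :* e′)) := t :* y :* y′ :* (e :* e′))
        refl 2# P.y P.e Q.y Q.e)

    -- Expanding `W` leaves r + r′ - 2xx′. Multiplied by e e′ this becomes e′(1 - u) + e(1 - u′) -
    -- 2vv′, in which the terms linear in u and u′ cancel.
    numerator : (2# * P.y * Q.y + W) * (P.e * Q.e) ≈ 2# * N
    numerator = ≈-by
      (Q.e ⊗⁰ sub≈0 P.re ⊕⁰ P.e ⊗⁰ sub≈0 Q.re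
        ⊕⁰ (- (2# * (Q.x * Q.e))) ⊗⁰ sub≈0 P.xe ⊕⁰ (2# * P.v) ⊗⁰ sub≈0 Q.xe)
      (solve 8 (λ u v x y u′ v′ x′ y′ →
        let one = con (+ 1) ; two = one :+ one ; e = one :+ u ; e′ = one :+ u′ in
        (two :* y :* y′ :+ ((x′ :- x) :* (x′ :- x) :+ (y′ :- y) :* (y′ :- y))) :* (e :* e′)
          :- two :* (one :- u :* u′ :- v :* v′) :=
        e′ :* ((x :* x :+ y :* y) :* e :- (one :- u))
        :+ e :* ((x′ :* x′ :+ y′ :* y′) :* e′ :- (one :- u′))
        :+ (:- (two :* (x′ :* e′))) :* (x :* e :- :- v)
        :+ two :* v :* (x′ :* e′ :- :- v′))
        refl P.u P.v P.x P.y Q.u Q.v Q.x Q.y)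

    doubled : (1# + δ) * (P.s * Q.s) - N ≈ 0#
    -- Twice the equation is proved, since the denominator 2yy′ of `δ` brings a factor 2 into
    -- `heights` and `numerator`.
    doubled = *-cancel-≉0 2≉0 (trans
      (solve 7 (λ δ S N t Y W E →
        (((con (+ 1) :+ δ) :* S :- N) :* t) :=
        (con (+ 1) :+ δ) :* (t :* S :- Y :* E) :+ E :* (δ :* Y :- W)
        :+ con (+ 1) :* ((Y :+ W) :* E :- t :* N))
        refl δ (P.s * Q.s) N 2# (2# * P.y * Q.y) W (P.e * Q.e))
      ((1# + δ) ⊗⁰ sub≈0 heights ⊕⁰ (P.e * Q.e) ⊗⁰ sub≈0 δ-def ⊕⁰ 1# ⊗⁰ sub≈0 numerator))

  -- Bijectivity onto the upper half plane.

  toUpper-cong : ∀ {p q} → p ≈ᴷ q → toUpper p ≈ᴴ toUpper q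
  toUpper-cong {p} (u≈ , v≈) =
    /-cong (1+u≉0 p) (+-congˡ u≈) (-‿cong v≈) ,
    /-cong (1+u≉0 p) (+-congˡ u≈) (√-cong (proj₁ (height²-pos p))
      (+-cong (+-congˡ (-‿cong (*-cong u≈ u≈))) (-‿cong (*-cong v≈ v≈))))

  1+norm-pos : ∀ x y → 0# < 1# + (x * x + y * y)
  1+norm-pos x y = 0<1 ⊕ˢ (sq≥0 x ⊕ sq≥0 y)

  toUpper-injective : ∀ {p q} → toUpper p ≈ᴴ toUpper q → p ≈ᴷ q
  toUpper-injective {p} {q} (x≈ , y≈) = u≈ , v≈
    where
    module P = ToUpper p
    module Q = ToUpper q

    u≈ : P.u ≈ Q.u
    -- Both points satisfy e(1 + r) = 2 with the same `r`, so they share `e`; the positive factor 1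
    -- + r is cancelled.
    u≈ = ≈-by (*-cancel-≉0 (>0⇒≉0 (1+norm-pos P.x P.y)) (trans
      (solve 6 (λ u x y u′ x′ y′ →
        let one = con (+ 1) in
        (u :- u′) :* (one :+ (x :* x :+ y :* y)) :=
        one :* ((x :* x :+ y :* y) :* (one :+ u) :- (one :- u))
        :+ (:- one) :* ((x′ :* x′ :+ y′ :* y′) :* (one :+ u′) :- (one :- u′))
        :+ (:- ((one :+ u′) :* (x :+ x′))) :* (x :- x′)
        :+ (:- ((one :+ u′) :* (y :+ y′))) :* (y :- y′))
        refl P.u P.x P.y Q.u Q.x Q.y)
      (1# ⊗⁰ sub≈0 P.re ⊕⁰ (- 1#) ⊗⁰ sub≈0 Q.re
        ⊕⁰ (- (Q.e * (P.x + Q.x))) ⊗⁰ sub≈0 x≈ ⊕⁰ (- (Q.e * (P.y + Q.y))) ⊗⁰ sub≈0 y≈))) refl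

    v≈ : P.v ≈ Q.v
    v≈ = ≈-by
      (1# ⊗⁰ sub≈0 P.xe ⊕⁰ (- 1#) ⊗⁰ sub≈0 Q.xe ⊕⁰ (- P.e) ⊗⁰ sub≈0 x≈ ⊕⁰ (- Q.x) ⊗⁰ sub≈0 u≈)
      (solve 6 (λ u v x u′ v′ x′ →
        let one = con (+ 1) in
        v :- v′ := one :* (x :* (one :+ u) :- :- v) :+ (:- one) :* (x′ :* (one :+ u′) :- :- v′)
          :+ (:- (one :+ u)) :* (x :- x′) :+ (:- x′) :* (u :- u′))
        refl P.u P.v P.x Q.u Q.v Q.x)

  module FromUpper (z : UpperHalfPlane) where
    open UpperHalfPlane z

    -- These solve (1 + U) t = 2 and V = - x(1 + U), the relations that hold on the image of
    -- `toUpper`.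
    t j U V : Carrier
    t = 1# + (x * x + y * y)
    j = t ⁻¹
    U = 2# * j - 1#
    V = - (2# * x * j)

    0<t : 0# < t
    0<t = 1+norm-pos x y

    root-pos : 0# < 2# * y * j
    root-pos = 0<2 ⊗ˢ y>0 ⊗ˢ ⁻¹-pos 0<t

    -- Writing 4j as 4j²t leaves only the y² part of `t`. A positive square here both places (U, V)
    -- in the disk and identifies the square root in `toUpper`.
    inside-gap : 1# - (U * U + V * V) ≈ 2# * y * j * (2# * y * j)
    inside-gap = ≈-by ((- (4# * j)) ⊗⁰ inverse-≈0 (>0⇒≉0 0<t))
      (solve 3 (λ x y j →
        let one = con (+ 1) ; two = one :+ one ; four = two :+ two ; U = two :* j :- one in
        one :- (U :* U :+ (:- (two :* x :* j)) :* (:- (two :* x :* j))) :- two :* y :* j :* (two :* y :* j) :=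
        (:- (four :* j)) :* ((one :+ (x :* x :+ y :* y)) :* j :- one)) refl x y j)

    preimage : KleinDisk
    preimage = disk U V (<-by (root-pos ⊗ˢ root-pos) inside-gap)

    toUpper-preimage : toUpper preimage ≈ᴴ z
    toUpper-preimage =
      sym (/-unique (1+u≉0 preimage)
        (solve 3 (λ t x j → x :* (con (+ 1) :+ (t :* j :- con (+ 1))) := :- (:- (t :* x :* j))) refl 2# x j)) ,
      sym (/-unique (1+u≉0 preimage) (trans
        (solve 3 (λ t y j → y :* (con (+ 1) :+ (t :* j :- con (+ 1))) := t :* y :* j) refl 2# y j)
        (sym (√-unique (proj₁ root-pos) (trans (sym inside-gap)
          (solve 2 (λ u v → con (+ 1) :- (u :* u :+ v :* v) := con (+ 1) :- u :* u :- v :* v) refl U V))))))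

  toUpper-isBijection : IsBijection _≈ᴷ_ _≈ᴴ_ toUpper
  toUpper-isBijection = record
    { isInjection = record
      { isCongruent = record
        { cong           = λ {p} {q} → toUpper-cong {p} {q}
        ; isEquivalence₁ = record
          { refl  = refl , refl
          ; sym   = λ (p , q) → sym p , sym q
          ; trans = λ (p , q) (p′ , q′) → trans p p′ , trans q q′
          }
        ; isEquivalence₂ = record
          { refl  = refl , refl
          ; sym   = λ (p , q) → sym p , sym q
          ; trans = λ (p , q) (p′ , q′) → trans p p′ , trans q q′
          }
        }
      ; injective = λ {p} {q} → toUpper-injective {p} {q}
      }
    ; surjective = λ z → let open FromUpper z in
        -- Surjectivity is required for every `k` equal to the preimage, hence the detour through
        -- `toUpper-cong`.
        preimage , λ {k} k≈ →
          let (x≈ , y≈) = toUpper-cong {k} {preimage} k≈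
              (x≈′ , y≈′) = toUpper-preimage
          in trans x≈ x≈′ , trans y≈ y≈′
    }

corollary4p10 : (R : CompleteOrderedField) → let open Klein R in
    IsBijection _∼_ _∼_ φ
    × (∀ p → p ∈ InKleinDisk ⇔ φ p ∈ NegativeDiscriminant)
    × (∀ k q → q ∼ φ [ k ] → quadraticFormula q ≐ kleinFormula k)
    × (∃ λ (f : KleinDisk → UpperHalfPlane) → (∀ k → toℂ (f k) ∈ kleinFormula k) × IsIsometry f)
corollary4p10 R =
  φ-isBijection R ,
  (λ p → mk⇔ (klein⇒negative R p) (negative⇒klein R p)) ,
  quadratic≐klein R ,
  -- `inj₁` is the root with the + sign, the one with positive imaginary part.
  toUpper R , (λ k → inj₁ (refl , refl)) , toUpper-isBijection R , isometry R
  where open CompleteOrderedField R using (refl)
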